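{- For any system $F$ of $\mathbb{F}_2$-linear equations that is an $(r,s+3)$-boundary expander, $\mathrm{depth}_{\mathsf{sCP}}(F)\ge rs/2$.
   Context: The constraint-variable graph $G_F=(F\cup V,E)$ is bipartite with a vertex for each equation and each variable, and an edge $(C,x)$ if $x$ occurs in $C$. For a bipartite graph $G=(U\cup V,E)$ and $W\subseteq U$, $\Gamma(v)$ is the neighbourhood of $v$, the boundary is $\delta(W):=\{v\in V:|\Gamma(v)\cap W|=1\}$, and the boundary expansion of $W$ is $|\delta(W)|/|W|$. $G$ is an $(r,s)$-boundary expander if every $W\subseteq U$ with $|W|\le r$ has boundary expansion at least $s$; $F$ is an $(r,s)$-boundary expander if $G_F$ is. $\mathrm{depth}_{\mathsf{sCP}}(F)$ is the minimum depth of a Semantic Cutting Planes refutation of the CNF encoding of $F$ (each equation written as clauses ruling out its falsifying assignments, translated into linear inequalities in the standard way). Semantic Cutting Planes: each line is an input inequality or is deduced from at most two earlier lines by the rule that every $\{0,1\}$ assignment satisfying the premises satisfies the conclusion; a refutation derives an unsatisfiable inequality; depth is the longest path in the proof DAG. -}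

module Defs where

open import Data.Bool using (Bool; true; false; if_then_else_; _xor_; _∧_; not)
open import Data.Nat as ℕ using (ℕ; zero; suc)
open import Data.Fin using (Fin; zero; suc)
open import Data.Fin.Subset using (Subset; inside; outside; ∣_∣)
open import Data.Vec using (lookup; tabulate)
open import Data.Integer as ℤ using (ℤ; +_)
open import Data.Rational as ℚ using (ℚ)
open import Relation.Nullary using (¬_)
open import Relation.Binary.PropositionalEquality using (_≡_)

sumℤ : ∀ {n} → (Fin n → ℤ) → ℤ
sumℤ {zero}  f = + 0
sumℤ {suc n} f = f zero ℤ.+ sumℤ (λ i → f (suc i))

countB : ∀ {n} → (Fin n → Bool) → ℕ
countB {zero}  f = 0
countB {suc n} f = (if f zero then 1 else 0) ℕ.+ countB (λ i → f (suc i))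

xorB : ∀ {n} → (Fin n → Bool) → Bool
xorB {zero}  f = false
xorB {suc n} f = f zero xor xorB (λ i → f (suc i))

memB : ∀ {n} → Fin n → Subset n → Bool
memB i S with lookup S i
... | inside  = true
... | outside = false

-- Systems of F₂-linear equations in n variables with m equations.
-- Equation j : ⊕_{i ∈ vars j} x_i = rhs j.
record System (n m : ℕ) : Set where
  field
    vars : Fin m → Subset n
    rhs  : Fin m → Bool
open System public

Assign : ℕ → Set
Assign n = Fin n → Bool

SatEq : ∀ {n m} → System n m → Fin m → Assign n → Set
SatEq F j α = xorB (λ i → memB i (vars F j) ∧ α i) ≡ rhs F j

boundary : ∀ {n m} → System n m → Subset m → Subset n
boundary {n} {m} F W =
  tabulate (λ v → if ℕ._≡ᵇ_ (countB (λ j → memB j W ∧ memB v (vars F j))) 1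
                    then inside else outside)

fromℕ : ℕ → ℚ
fromℕ k = (+ k) ℚ./ 1

IsBoundaryExpander : ∀ {n m} → System n m → ℕ → ℚ → Set
IsBoundaryExpander {n} {m} F r e =
  (W : Subset m) → ∣ W ∣ ℕ.≤ r → e ℚ.* fromℕ ∣ W ∣ ℚ.≤ fromℕ ∣ boundary F W ∣

-- Linear inequalities  Σ_i coef i · x_i ≥ bound  with integer coefficients.
record Ineq (n : ℕ) : Set where
  constructor mkIneq
  field
    coef  : Fin n → ℤ
    bound : ℤ
open Ineq public

bit : Bool → ℤ
bit true  = + 1
bit false = + 0

SatIneq : ∀ {n} → Assign n → Ineq n → Set
SatIneq α I = bound I ℤ.≤ sumℤ (λ i → coef I i ℤ.* bit (α i))

-- CNF encoding: for equation j and a (restriction of a) falsifying assignment β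
-- on its variables, the clause  ∨_{i ∈ vars j} (x_i ≠ β i), translated as
--   Σ_{β i = 0} x_i + Σ_{β i = 1} (1 - x_i) ≥ 1,
-- i.e.  Σ_{i∈vars j, β i=0} x_i - Σ_{i∈vars j, β i=1} x_i ≥ 1 - #{i∈vars j : β i = 1}.
clauseIneq : ∀ {n m} → System n m → Fin m → Assign n → Ineq n
clauseIneq F j β =
  mkIneq (λ i → if memB i (vars F j) then (if β i then ℤ.- (+ 1) else + 1) else + 0)
         (+ 1 ℤ.- + countB (λ i → memB i (vars F j) ∧ β i))

-- Semantic Cutting Planes derivations (tree unfolding of the proof DAG;
-- depth of the DAG = depth of its unfolding).
data SCP {n m : ℕ} (F : System n m) : Ineq n → Set where
  axiom : (j : Fin m) (β : Assign n) → ¬ SatEq F j β → SCP F (clauseIneq F j β)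
  rule0 : {J : Ineq n} → (∀ α → SatIneq α J) → SCP F J
  rule1 : {I J : Ineq n} → SCP F I → (∀ α → SatIneq α I → SatIneq α J) → SCP F J
  rule2 : {I I' J : Ineq n} → SCP F I → SCP F I' →
          (∀ α → SatIneq α I → SatIneq α I' → SatIneq α J) → SCP F J

depth : ∀ {n m} {F : System n m} {J : Ineq n} → SCP F J → ℕ
depth (axiom _ _ _)  = 0
depth (rule0 _)      = 0
depth (rule1 p _)    = suc (depth p)
depth (rule2 p q _)  = suc (depth p ℕ.⊔ depth q)

record Refutation {n m : ℕ} (F : System n m) : Set where
  field
    concl  : Ineq n
    unsat  : ∀ α → ¬ SatIneq α concl
    proof  : SCP F concl
open Refutation public

refDepth : ∀ {n m} {F : System n m} → Refutation F → ℕ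
refDepth π = depth (proof π)

{-# OPTIONS --safe #-}
module Submission where

-- Follow a refutation from its conclusion towards the axioms, keeping a partial
-- assignment ρ such that the current line fails strictly at the centre of the
-- subcube of completions of ρ.  If I₁, I₂ imply J and J fails at the centre, then
-- fixing at most two further variables makes I₁ or I₂ fail at the new centre:
-- otherwise a two-dimensional balancing argument yields antipodal completions
-- which both satisfy I₁ and I₂, although one of them must falsify J.
--
-- After each step a maximal set C of equations with at most 3|C| unqueried
-- boundary variables is closed, and all its variables are fixed so that its
-- equations hold.  In every intermediate set some equation has two private free
-- variables, and the two solutions for these are antipodal, so one of them keeps
-- the current line failing.  Expansion gives s|C| ≤ #queried ≤ 2 · #steps, hence
-- |C| < r as long as fewer than rs/2 steps were made, and then no axiom fails:
-- its equation is either closed or has two free variables.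

open import Defs
open import Data.Bool using (Bool; true; false; not; _∧_; _xor_; if_then_else_)
import Data.Bool.Properties as Bool
open import Data.Empty using (⊥-elim)
open import Data.Fin using (Fin; zero; suc)
import Data.Fin.Properties as Fin
open import Data.Integer as ℤ using (ℤ; +_; -[1+_]; +≤+)
import Data.Integer.Properties as ℤ
open import Data.List using (List; []; _∷_; allFin)
open import Data.List.Membership.Propositional using () renaming (_∈_ to _∈ᴸ_)
open import Data.List.Membership.Propositional.Properties using (∈-allFin)
open import Data.List.Relation.Unary.Any as Any using ()
open import Data.Maybe using (Maybe; just; nothing; fromMaybe)
open import Data.Maybe.Properties using (just-injective)
open import Data.Nat as ℕ using (ℕ; zero; suc; z≤n; s≤s)
import Data.Nat.Properties as ℕ
open import Data.Product using (∃; ∃₂; _×_; _,_; proj₁; proj₂)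
open import Data.Sum using (_⊎_; inj₁; inj₂)
open import Data.Vec as Vec using (lookup; []; _∷_)
open import Data.Vec.Functional as VF using (updateAt)
open import Data.Vec.Functional.Properties using (updateAt-updates; updateAt-minimal)
open import Data.Vec.Properties using ([]=⇒lookup; lookup⇒[]=; lookup∘tabulate)
open import Function using (_∘_; const)
open import Relation.Binary.PropositionalEquality
open import Relation.Nullary using (¬_; Dec; yes; no; contradiction)
open import Relation.Nullary.Decidable using (¬?; _×-dec_; map′; decidable-stable)

-- Balancing integer vectors in the plane by signs

module Balancing where

  open import Data.Integer using (ℤ; +_; -[1+_]; _+_; _*_; -_; _-_; ∣_∣; _≤_; +≤+; -≤+)
  open import Data.Integer.Tactic.RingSolver using (solve-∀)

  sgn : Bool → ℤ
  sgn true  = + 1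
  sgn false = - + 1

  abs-≤ : ∀ {x n} → x ≤ + n → - x ≤ + n → ∣ x ∣ ℕ.≤ n
  abs-≤ {x = + _}      (+≤+ a≤n) _          = a≤n
  abs-≤ {x = -[1+ _ ]} _          (+≤+ a≤n) = a≤n

  ≤-abs : ∀ {x n} → ∣ x ∣ ℕ.≤ n → x ≤ + n
  ≤-abs {x = + _}      a≤n = +≤+ a≤n
  ≤-abs {x = -[1+ _ ]} _   = -≤+

  -- The largest step t/E in direction l that keeps p/D inside [-1,1] is T/∣l∣.
  StepLimit : ℕ → ℤ → ℤ → ℕ → Set
  StepLimit D p l T =
    (∀ E t → t ℕ.* ∣ l ∣ ℕ.≤ E ℕ.* T → ∣ + E * p + + t * l ∣ ℕ.≤ E ℕ.* D) ×
    (∃ λ σ → + ∣ l ∣ * p + + T * l ≡ + (∣ l ∣ ℕ.* D) * sgn σ)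

  -- A nonnegative direction can only run into the face `+1`, from which `p` is `D - p` away (in
  -- units of `1/D`); this distance is `T`.
  stepLimit⁺ : ∀ D p k → ∣ p ∣ ℕ.≤ D → ∃ (StepLimit D p (+ k))
  stepLimit⁺ D p k ∣p∣≤D = T , inside , true , tight
    where
    T = ∣ + D - p ∣
    T≡ : + T ≡ + D - p
    T≡ = ℤ.0≤i⇒+∣i∣≡i (ℤ.i≤j⇒0≤j-i (≤-abs {p} ∣p∣≤D))
    tight : + k * p + + T * + k ≡ + (k ℕ.* D) * sgn true
    tight = trans (cong (λ T → + k * p + T * + k) T≡)
           (trans (lemma (+ k) p (+ D)) (cong (_* + 1) (sym (ℤ.pos-* k D))))
      where
      lemma : ∀ k p D → k * p + (D - p) * k ≡ k * D * + 1
      lemma = solve-∀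
    inside : ∀ E t → t ℕ.* k ℕ.≤ E ℕ.* T → ∣ + E * p + + t * + k ∣ ℕ.≤ E ℕ.* D
    inside E t tk≤ET = abs-≤ upper lower
      where
      open ℤ.≤-Reasoning
      step : + t * + k ≤ + E * (+ D - p)
      step = begin
        + t * + k        ≡⟨ ℤ.pos-* t k ⟨
        + (t ℕ.* k)      ≤⟨ +≤+ tk≤ET ⟩
        + (E ℕ.* T)      ≡⟨ ℤ.pos-* E T ⟩
        + E * + T        ≡⟨ cong (+ E *_) T≡ ⟩
        + E * (+ D - p)  ∎
      upper : + E * p + + t * + k ≤ + (E ℕ.* D)
      upper = begin
        + E * p + + t * + k        ≤⟨ ℤ.+-monoʳ-≤ (+ E * p) step ⟩
        + E * p + + E * (+ D - p)  ≡⟨ lemma (+ E) p (+ D) ⟩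
        + E * + D                  ≡⟨ ℤ.pos-* E D ⟨
        + (E ℕ.* D)                ∎
        where
        lemma : ∀ E p D → E * p + E * (D - p) ≡ E * D
        lemma = solve-∀
      -- Moving upwards cannot cross the face `-1`: the term `t * k` is nonnegative and is dropped,
      -- leaving the bound on `p` itself.
      lower : - (+ E * p + + t * + k) ≤ + (E ℕ.* D)
      lower = begin
        - (+ E * p + + t * + k)      ≡⟨ lemma (+ E) p (+ t * + k) ⟩
        + E * - p + - (+ t * + k)    ≤⟨ ℤ.+-monoʳ-≤ (+ E * - p) (ℤ.neg-mono-≤ (subst (+ 0 ≤_) (ℤ.pos-* t k) (+≤+ z≤n))) ⟩
        + E * - p + + 0              ≡⟨ ℤ.+-identityʳ _ ⟩
        + E * - p                    ≤⟨ ℤ.*-monoˡ-≤-nonNeg (+ E) (≤-abs { - p} (subst (ℕ._≤ D) (sym (ℤ.∣-i∣≡∣i∣ p)) ∣p∣≤D)) ⟩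
        + E * + D                    ≡⟨ ℤ.pos-* E D ⟨
        + (E ℕ.* D)                  ∎
        where
        lemma : ∀ E p x → - (E * p + x) ≡ E * - p + - x
        lemma = solve-∀

  -- A negative direction is reduced to a positive one by reflecting both `p` and `l`, which also
  -- flips the sign of the face that is hit.
  stepLimit : ∀ D p l → ∣ p ∣ ℕ.≤ D → ∃ (StepLimit D p l)
  stepLimit D p (+ k)      ∣p∣≤D = stepLimit⁺ D p k ∣p∣≤D
  stepLimit D p l@(-[1+ k ]) ∣p∣≤D
    with T , inside , σ , tight ← stepLimit⁺ D (- p) (suc k) (subst (ℕ._≤ D) (sym (ℤ.∣-i∣≡∣i∣ p)) ∣p∣≤D)
    = T
    , (λ E t h → subst (ℕ._≤ E ℕ.* D) (trans (sym (ℤ.∣-i∣≡∣i∣ (+ E * - p + + t * + suc k))) (cong ∣_∣ (flip (+ E) p (+ t) (+ suc k)))) (inside E t h))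
    , not σ
    , trans (sym (flip (+ suc k) p (+ T) (+ suc k))) (trans (cong -_ tight) (lemma (+ (suc k ℕ.* D)) σ))
    where
    flip : ∀ E p t l → - (E * - p + t * l) ≡ E * p + t * - l
    flip = solve-∀
    lemma : ∀ x σ → - (x * sgn σ) ≡ x * sgn (not σ)
    lemma x true  = ℤ.neg-distribʳ-* x (+ 1)
    lemma x false = ℤ.neg-distribʳ-* x (- + 1)

  -- Transitivity of `a/b ≤ c/d ≤ e/f` in cross-multiplied form; the middle denominator is the
  -- factor that gets cancelled.
  fraction-trans : ∀ {a b c d e f} → 0 ℕ.< d → a ℕ.* d ℕ.≤ b ℕ.* c → c ℕ.* f ℕ.≤ d ℕ.* e → a ℕ.* f ℕ.≤ b ℕ.* e
  fraction-trans {a} {b} {c} {d} {e} {f} 0<d ad≤bc cf≤de = ℕ.*-cancelˡ-≤ d {{ℕ.>-nonZero 0<d}} (begin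
    d ℕ.* (a ℕ.* f)  ≡⟨ ℕ.*-assoc d a f ⟨
    d ℕ.* a ℕ.* f    ≡⟨ cong (ℕ._* f) (ℕ.*-comm d a) ⟩
    a ℕ.* d ℕ.* f    ≤⟨ ℕ.*-monoˡ-≤ f ad≤bc ⟩
    b ℕ.* c ℕ.* f    ≡⟨ ℕ.*-assoc b c f ⟩
    b ℕ.* (c ℕ.* f)  ≤⟨ ℕ.*-monoʳ-≤ b cf≤de ⟩
    b ℕ.* (d ℕ.* e)  ≡⟨ ℕ.*-assoc b d e ⟨
    b ℕ.* d ℕ.* e    ≡⟨ cong (ℕ._* e) (ℕ.*-comm b d) ⟩
    d ℕ.* b ℕ.* e    ≡⟨ ℕ.*-assoc d b e ⟩
    d ℕ.* (b ℕ.* e)  ∎)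
    where open ℕ.≤-Reasoning

  -- The ratio test: `T i / E i` is least among all fractions, where a denominator `E j` equal to 0
  -- stands for infinity, that is, for a coordinate that never reaches the boundary.
  minFraction : ∀ {k} (T E : Fin k → ℕ) → (∃ λ i → 0 ℕ.< E i) →
                ∃ λ i → 0 ℕ.< E i × (∀ j → T i ℕ.* E j ℕ.≤ E i ℕ.* T j)
  minFraction {suc k} T E pos with Fin.any? (λ i → 0 ℕ.<? E (suc i))
  ... | no none = zero , 0<E₀ pos , λ
      { zero    → ℕ.≤-reflexive (ℕ.*-comm (T zero) _)
      ; (suc j) → subst (λ e → T zero ℕ.* e ℕ.≤ E zero ℕ.* T (suc j)) (sym (E≡0 j))
                    (ℕ.≤-trans (ℕ.≤-reflexive (ℕ.*-zeroʳ (T zero))) z≤n) }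
    where
    E≡0 : ∀ j → E (suc j) ≡ 0
    E≡0 j = ℕ.n≤0⇒n≡0 (ℕ.≮⇒≥ (λ lt → none (j , lt)))
    0<E₀ : (∃ λ i → 0 ℕ.< E i) → 0 ℕ.< E zero
    0<E₀ (zero  , lt) = lt
    0<E₀ (suc i , lt) = ⊥-elim (none (i , lt))
  ... | yes pos′ with minFraction (T ∘ suc) (E ∘ suc) pos′
  ...   | i , 0<Ei , least with T (suc i) ℕ.* E zero ℕ.≤? E (suc i) ℕ.* T zero
  ...     | yes le = suc i , 0<Ei , λ { zero → le ; (suc j) → least j }
  ...     | no  gt = zero , 0<E₀ , λ
      { zero    → ℕ.≤-reflexive (ℕ.*-comm (T zero) _)
      ; (suc j) → fraction-trans {T zero} {E zero} {T (suc i)} 0<Ei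
                    (subst₂ ℕ._≤_ (ℕ.*-comm (E (suc i)) _) (ℕ.*-comm (T (suc i)) _) (ℕ.≰⇒≥ gt)) (least j) }
    where
    0<E₀ : 0 ℕ.< E zero
    0<E₀ with E zero
    ... | zero  = ⊥-elim (gt (ℕ.≤-trans (ℕ.≤-reflexive (ℕ.*-zeroʳ (T (suc i)))) z≤n))
    ... | suc _ = s≤s z≤n

  -- The point p/D of the cube [-1,1]ᵏ is moved along l until it hits the boundary.
  moveToBoundary : ∀ {k} D (p l : Fin k → ℤ) → 0 ℕ.< D → (∀ i → ∣ p i ∣ ℕ.≤ D) → (∃ λ i → 0 ℕ.< ∣ l i ∣) →
    ∃₂ λ D′ (p′ : Fin k → ℤ) → 0 ℕ.< D′ × (∀ i → ∣ p′ i ∣ ℕ.≤ D′) ×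
      (∃₂ λ i σ → p′ i ≡ + D′ * sgn σ) ×
      (∃₂ λ E t → + D′ ≡ E * + D × (∀ i → p′ i ≡ E * p i + t * l i))
  moveToBoundary D p l 0<D ∣p∣≤D l≢0
    with i , 0<Ei , least ← minFraction (λ i → proj₁ (stepLimit D (p i) (l i) (∣p∣≤D i))) (λ i → ∣ l i ∣) l≢0
    = ∣ l i ∣ ℕ.* D , (λ j → + ∣ l i ∣ * p j + + T i * l j) , ℕ.*-mono-< 0<Ei 0<D
    , (λ j → proj₁ (proj₂ (stepLimit D (p j) (l j) (∣p∣≤D j))) ∣ l i ∣ (T i) (least j))
    , (i , proj₂ (proj₂ (stepLimit D (p i) (l i) (∣p∣≤D i))))
    , + ∣ l i ∣ , + T i , ℤ.pos-* ∣ l i ∣ D , λ _ → refl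
    where
    T = λ i → proj₁ (stepLimit D (p i) (l i) (∣p∣≤D i))

  Plane : Set
  Plane = Fin 2 → ℤ

  -- If `u` and `v` are independent, Cramer's rule supplies the three 2×2 minors as coefficients.
  -- Otherwise a nonzero coordinate of `u` gives a relation between `u` and `v` alone, and if `u`
  -- vanishes its coefficient is 1.
  dependency : ∀ (u v w : Plane) → ∃ λ (l : Fin 3 → ℤ) → (∃ λ i → 0 ℕ.< ∣ l i ∣) ×
    (∀ c → l zero * u c + l (suc zero) * v c + l (suc (suc zero)) * w c ≡ + 0)
  dependency u v w = go
    where
    x y : Fin 2
    x = zero
    y = suc zero
    infix 8 _⨯_
    _⨯_ : Plane → Plane → ℤ
    a ⨯ b = a x * b y - a y * b x
    pos : ∀ {a} → a ≢ + 0 → 0 ℕ.< ∣ a ∣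
    pos {a} a≢0 = ℕ.n≢0⇒n>0 (a≢0 ∘ ℤ.∣i∣≡0⇒i≡0)
    fst : ∀ a b c d e f → (a * d - b * c) ≡ + 0 → c * b + - a * d + + 0 * f ≡ + 0
    fst a b c d e f h = trans (lemma a b c d f) (cong -_ h)
      where
      lemma : ∀ a b c d f → c * b + - a * d + + 0 * f ≡ - (a * d - b * c)
      lemma = solve-∀
    snd : ∀ a b c d e f → (a * d - b * c) ≡ + 0 → d * a + - b * c + + 0 * f ≡ + 0
    snd a b c d e f h = trans (lemma a b c d f) h
      where
      lemma : ∀ a b c d f → d * a + - b * c + + 0 * f ≡ a * d - b * c
      lemma = solve-∀
    diag : ∀ a b f → b * a + - a * b + + 0 * f ≡ + 0
    diag = solve-∀
    unit : ∀ {a} v w → a ≡ + 0 → + 1 * a + + 0 * v + + 0 * w ≡ + 0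
    unit v w refl = refl
    cramerˣ : ∀ a b c d e f → (c * f - d * e) * a + (e * b - f * a) * c + (a * d - b * c) * e ≡ + 0
    cramerˣ = solve-∀
    cramerʸ : ∀ a b c d e f → (c * f - d * e) * b + (e * b - f * a) * d + (a * d - b * c) * f ≡ + 0
    cramerʸ = solve-∀
    go : ∃ λ (l : Fin 3 → ℤ) → (∃ λ i → 0 ℕ.< ∣ l i ∣) ×
      (∀ c → l zero * u c + l (suc zero) * v c + l (suc (suc zero)) * w c ≡ + 0)
    go with u ⨯ v ℤ.≟ + 0 | u x ℤ.≟ + 0 | u y ℤ.≟ + 0
    ... | no uv≢0 | _ | _ =
        v ⨯ w VF.∷ w ⨯ u VF.∷ u ⨯ v VF.∷ VF.[]
      , (suc (suc zero) , pos uv≢0)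
      , λ { zero       → cramerˣ (u x) (u y) (v x) (v y) (w x) (w y)
          ; (suc zero) → cramerʸ (u x) (u y) (v x) (v y) (w x) (w y) }
    ... | yes uv≡0 | no ux≢0 | _ =
        v x VF.∷ - u x VF.∷ + 0 VF.∷ VF.[]
      , (suc zero , subst (0 ℕ.<_) (sym (ℤ.∣-i∣≡∣i∣ (u x))) (pos ux≢0))
      , λ { zero       → diag (u x) (v x) (w x)
          ; (suc zero) → fst (u x) (u y) (v x) (v y) (w x) (w y) uv≡0 }
    ... | yes uv≡0 | yes _ | no uy≢0 =
        v y VF.∷ - u y VF.∷ + 0 VF.∷ VF.[]
      , (suc zero , subst (0 ℕ.<_) (sym (ℤ.∣-i∣≡∣i∣ (u y))) (pos uy≢0))
      , λ { zero       → snd (u x) (u y) (v x) (v y) (w y) (w x) uv≡0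
          ; (suc zero) → diag (u y) (v y) (w y) }
    ... | yes _ | yes ux≡0 | yes uy≡0 =
        + 1 VF.∷ + 0 VF.∷ + 0 VF.∷ VF.[]
      , (zero , s≤s z≤n)
      , λ { zero       → unit (v x) (w x) ux≡0
          ; (suc zero) → unit (v y) (w y) uy≡0 }

  -- The sign of `p` is chosen, so the rounding error is `D - ∣ p ∣`.
  round : ∀ D p → ∣ p ∣ ℕ.≤ D → ∃ λ σ → ∣ + D * sgn σ - p ∣ ℕ.≤ D
  round D (+ a) a≤D = true , subst (ℕ._≤ D) (cong ∣_∣ lemma) (ℕ.m∸n≤m D a)
    where
    lemma : + (D ℕ.∸ a) ≡ + D * + 1 - + a
    lemma = trans (sym (ℤ.⊖-≥ a≤D)) (trans (sym (ℤ.m-n≡m⊖n D a)) (cong (_- + a) (sym (ℤ.*-identityʳ (+ D)))))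
  round D -[1+ a ] a≤D = false , subst (ℕ._≤ D) (trans (sym (ℤ.∣-i∣≡∣i∣ (+ (D ℕ.∸ suc a)))) (cong ∣_∣ lemma)) (ℕ.m∸n≤m D (suc a))
    where
    negate : ∀ D a → - (D - a) ≡ D * - + 1 - - a
    negate = solve-∀
    lemma : - + (D ℕ.∸ suc a) ≡ + D * - + 1 - -[1+ a ]
    lemma = trans (cong -_ (trans (sym (ℤ.⊖-≥ a≤D)) (sym (ℤ.m-n≡m⊖n D (suc a))))) (negate (+ D) (+ suc a))

  shift : Plane → Plane → ℤ → Plane
  shift S v s c = S c + v c * s

  -- With the denominator `D` cleared: the decided part `S` plus `u` and `v` with fractional signs
  -- `p/D` and `q/D` is zero. Vectors not yet reached carry the sign 0.
  record ZeroSum₂ (D p q : ℤ) (S u v : Plane) : Set where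
    constructor zeroSum₂
    field
      vanishes : ∀ c → D * S c + p * u c + q * v c ≡ + 0

  record ZeroSum₃ (D p q r : ℤ) (S u v w : Plane) : Set where
    constructor zeroSum₃
    field
      vanishes : ∀ c → D * S c + p * u c + q * v c + r * w c ≡ + 0

  -- Moving along a linear dependency adds a multiple of zero. The new vector `w` enters with sign
  -- 0, hence the term `E * + 0`.
  move-zeroSum : ∀ {D p q D′ p′ q′ r′ S u v w} E t a b c → ZeroSum₂ D p q S u v →
    (∀ x → a * u x + b * v x + c * w x ≡ + 0) →
    D′ ≡ E * D → p′ ≡ E * p + t * a → q′ ≡ E * q + t * b → r′ ≡ E * + 0 + t * c →
    ZeroSum₃ D′ p′ q′ r′ S u v w
  move-zeroSum {D} {p} {q} {S = S} {u} {v} {w} E t a b c (zeroSum₂ vanishes) dep refl refl refl refl = zeroSum₃ λ x → begin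
    E * D * S x + (E * p + t * a) * u x + (E * q + t * b) * v x + (E * + 0 + t * c) * w x
      ≡⟨ rearrange E D (S x) p (u x) q (v x) t a b c (w x) ⟩
    E * (D * S x + p * u x + q * v x) + t * (a * u x + b * v x + c * w x)
      ≡⟨ cong₂ (λ y z → E * y + t * z) (vanishes x) (dep x) ⟩
    E * + 0 + t * + 0
      ≡⟨ cong₂ _+_ (ℤ.*-zeroʳ E) (ℤ.*-zeroʳ t) ⟩
    + 0 ∎
    where
    open ≡-Reasoning
    rearrange : ∀ E D S p u q v t a b c w →
      E * D * S + (E * p + t * a) * u + (E * q + t * b) * v + (E * + 0 + t * c) * w
      ≡ E * (D * S + p * u + q * v) + t * (a * u + b * v + c * w)
    rearrange = solve-∀

  absorb₁ : ∀ {D p q r S u v w} s → p ≡ D * s → ZeroSum₃ D p q r S u v w → ZeroSum₂ D q r (shift S u s) v w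
  absorb₁ {D} {p} {q} {r} {S} {u} {v} {w} s refl (zeroSum₃ vanishes) = zeroSum₂ λ c → trans (regroup D (S c) (u c) s q (v c) r (w c)) (vanishes c)
    where
    regroup : ∀ D S u s q v r w → D * (S + u * s) + q * v + r * w ≡ D * S + D * s * u + q * v + r * w
    regroup = solve-∀

  rotate : ∀ {D p q r S u v w} → ZeroSum₃ D p q r S u v w → ZeroSum₃ D q p r S v u w
  rotate {D} {p} {q} {r} {S} {u} {v} {w} (zeroSum₃ vanishes) = zeroSum₃ λ c → trans (regroup D (S c) p (u c) q (v c) (r * w c)) (vanishes c)
    where
    regroup : ∀ D S p u q v x → D * S + q * v + p * u + x ≡ D * S + p * u + q * v + x
    regroup = solve-∀

  absorb₃ : ∀ {D p q r S u v w} s → r ≡ D * s → ZeroSum₃ D p q r S u v w → ZeroSum₂ D p q (shift S w s) u v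
  absorb₃ {D} {p} {q} {r} {S} {u} {v} {w} s refl (zeroSum₃ vanishes) = zeroSum₂ λ c → trans (regroup D (S c) (w c) s p (u c) q (v c)) (vanishes c)
    where
    regroup : ∀ D S w s p u q v → D * (S + w * s) + p * u + q * v ≡ D * S + p * u + q * v + D * s * w
    regroup = solve-∀

  -- The Bárány–Grinberg argument in the plane: a zero-sum fractional signing in
  -- which all but two signs are ±1 is kept, and each further vector lets one of
  -- three fractional signs be pushed to ±1; the last two are rounded.
  module _ (A : Fin 2 → ℕ) where

    Small : Plane → Plane → Set
    Small u v = ∀ c → ∣ u c ∣ ℕ.+ ∣ v c ∣ ℕ.≤ A c

    record Balanced {n} (f : Fin n → Plane) (S u v : Plane) : Set where
      constructor balanced
      field
        σ τ   : Bool
        y     : Fin n → Bool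
        small : ∀ c → ∣ S c + (u c * sgn σ + (v c * sgn τ + sumℤ (λ i → f i c * sgn (y i)))) ∣ ℕ.≤ A c

    unshift₁ : ∀ {n} (f : Fin (suc n) → Plane) {S u v} σ → Balanced (f ∘ suc) (shift S u (sgn σ)) v (f zero) → Balanced f S u v
    unshift₁ f {S} {u} {v} σ (balanced τ υ y small) = balanced σ τ (υ VF.∷ y) λ c →
      subst (λ x → ∣ x ∣ ℕ.≤ A c) (ℤ.+-assoc (S c) (u c * sgn σ) (v c * sgn τ + (f zero c * sgn υ + sumℤ (λ i → f (suc i) c * sgn (y i))))) (small c)

    unshift₂ : ∀ {n} (f : Fin (suc n) → Plane) {S u v} τ → Balanced (f ∘ suc) (shift S v (sgn τ)) u (f zero) → Balanced f S u v
    unshift₂ f {S} {u} {v} τ (balanced σ υ y small) = balanced σ τ (υ VF.∷ y) λ c →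
      subst (λ x → ∣ x ∣ ℕ.≤ A c) (swap (S c) (v c * sgn τ) (u c * sgn σ) (f zero c * sgn υ + sumℤ (λ i → f (suc i) c * sgn (y i)))) (small c)
      where
      swap : ∀ S v u s → S + v + (u + s) ≡ S + (u + (v + s))
      swap = solve-∀

    unshift₃ : ∀ {n} (f : Fin (suc n) → Plane) {S u v} υ → Balanced (f ∘ suc) (shift S (f zero) (sgn υ)) u v → Balanced f S u v
    unshift₃ f {S} {u} {v} υ (balanced σ τ y small) = balanced σ τ (υ VF.∷ y) λ c →
      subst (λ x → ∣ x ∣ ℕ.≤ A c) (swap (S c) (f zero c * sgn υ) (u c * sgn σ) (v c * sgn τ) (sumℤ (λ i → f (suc i) c * sgn (y i)))) (small c)
      where
      swap : ∀ S w u v s → S + w + (u + (v + s)) ≡ S + (u + (v + (w + s)))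
      swap = solve-∀

    -- Rounding changes each of the two signs by at most 1, so the sum moves from zero by at most
    -- `∣ u c ∣ + ∣ v c ∣` in coordinate `c`, which `Small u v` bounds.
    roundTwo : ∀ (f : Fin 0 → Plane) S u v D p q → 0 ℕ.< D → ∣ p ∣ ℕ.≤ D → ∣ q ∣ ℕ.≤ D →
      ZeroSum₂ (+ D) p q S u v → Small u v → Balanced f S u v
    roundTwo f S u v D p q 0<D ∣p∣≤D ∣q∣≤D (zeroSum₂ vanishes) uv
      with σ , ∣σ-p∣≤D ← round D p ∣p∣≤D | τ , ∣τ-q∣≤D ← round D q ∣q∣≤D
      = balanced σ τ VF.[] λ c → ℕ.*-cancelˡ-≤ D {{ℕ.>-nonZero 0<D}} (scaled σ τ c ∣σ-p∣≤D ∣τ-q∣≤D)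
      where
      open ℕ.≤-Reasoning
      rearrange : ∀ D S p u q v σ τ →
        D * (S + (u * σ + (v * τ + + 0))) ≡ (D * S + p * u + q * v) + ((D * σ - p) * u + (D * τ - q) * v)
      rearrange = solve-∀
      errors : ∀ s t c → + D * (S c + (u c * s + (v c * t + + 0))) ≡ (+ D * s - p) * u c + (+ D * t - q) * v c
      errors s t c = trans (rearrange (+ D) (S c) p (u c) q (v c) s t)
        (trans (cong (λ x → x + ((+ D * s - p) * u c + (+ D * t - q) * v c)) (vanishes c))
               (ℤ.+-identityˡ ((+ D * s - p) * u c + (+ D * t - q) * v c)))
      scaled : ∀ σ τ c → ∣ + D * sgn σ - p ∣ ℕ.≤ D → ∣ + D * sgn τ - q ∣ ℕ.≤ D →
        D ℕ.* ∣ S c + (u c * sgn σ + (v c * sgn τ + + 0)) ∣ ℕ.≤ D ℕ.* A c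
      scaled σ τ c ∣σ-p∣≤D ∣τ-q∣≤D = begin
        D ℕ.* ∣ S c + (u c * sgn σ + (v c * sgn τ + + 0)) ∣
          ≡⟨ ℤ.∣i*j∣≡∣i∣*∣j∣ (+ D) (S c + (u c * sgn σ + (v c * sgn τ + + 0))) ⟨
        ∣ + D * (S c + (u c * sgn σ + (v c * sgn τ + + 0))) ∣
          ≡⟨ cong ∣_∣ (errors (sgn σ) (sgn τ) c) ⟩
        ∣ (+ D * sgn σ - p) * u c + (+ D * sgn τ - q) * v c ∣
          ≤⟨ ℤ.∣i+j∣≤∣i∣+∣j∣ ((+ D * sgn σ - p) * u c) ((+ D * sgn τ - q) * v c) ⟩
        ∣ (+ D * sgn σ - p) * u c ∣ ℕ.+ ∣ (+ D * sgn τ - q) * v c ∣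
          ≡⟨ cong₂ ℕ._+_ (ℤ.∣i*j∣≡∣i∣*∣j∣ (+ D * sgn σ - p) (u c)) (ℤ.∣i*j∣≡∣i∣*∣j∣ (+ D * sgn τ - q) (v c)) ⟩
        ∣ + D * sgn σ - p ∣ ℕ.* ∣ u c ∣ ℕ.+ ∣ + D * sgn τ - q ∣ ℕ.* ∣ v c ∣
          ≤⟨ ℕ.+-mono-≤ (ℕ.*-monoˡ-≤ ∣ u c ∣ ∣σ-p∣≤D) (ℕ.*-monoˡ-≤ ∣ v c ∣ ∣τ-q∣≤D) ⟩
        D ℕ.* ∣ u c ∣ ℕ.+ D ℕ.* ∣ v c ∣
          ≡⟨ ℕ.*-distribˡ-+ D ∣ u c ∣ ∣ v c ∣ ⟨
        D ℕ.* (∣ u c ∣ ℕ.+ ∣ v c ∣)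
          ≤⟨ ℕ.*-monoʳ-≤ D (uv c) ⟩
        D ℕ.* A c ∎

    -- Induction on the vectors still to come. Smallness is required of all pairs because it is not
    -- known in advance which two vectors survive until the final rounding.
    balance-from : ∀ {n} (f : Fin n → Plane) S u v D p q → 0 ℕ.< D → ∣ p ∣ ℕ.≤ D → ∣ q ∣ ℕ.≤ D →
      ZeroSum₂ (+ D) p q S u v →
      Small u v → (∀ i → Small u (f i)) → (∀ i → Small v (f i)) → (∀ i j → i ≢ j → Small (f i) (f j)) →
      Balanced f S u v
    balance-from {zero} f S u v D p q 0<D ∣p∣≤D ∣q∣≤D zs uv _ _ _ = roundTwo f S u v D p q 0<D ∣p∣≤D ∣q∣≤D zs uv
    balance-from {suc n} f S u v D p q 0<D ∣p∣≤D ∣q∣≤D zs uv uf vf ff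
      with l , l≢0 , dep ← dependency u v (f zero)
      with D′ , p′ , 0<D′ , ∣p′∣≤D′ , (i , σ , tight) , E , t , D′≡ , p′≡ ←
             moveToBoundary D (p VF.∷ q VF.∷ + 0 VF.∷ VF.[]) l 0<D
               (λ { zero → ∣p∣≤D ; (suc zero) → ∣q∣≤D ; (suc (suc zero)) → z≤n }) l≢0
      = go i tight
      where
      zs′ : ZeroSum₃ (+ D′) (p′ zero) (p′ (suc zero)) (p′ (suc (suc zero))) S u v (f zero)
      zs′ = move-zeroSum E t (l zero) (l (suc zero)) (l (suc (suc zero))) zs dep D′≡ (p′≡ zero) (p′≡ (suc zero)) (p′≡ (suc (suc zero)))
      ff′ : ∀ i j → i ≢ j → Small (f (suc i)) (f (suc j))
      ff′ i j i≢j = ff (suc i) (suc j) (i≢j ∘ Fin.suc-injective)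
      f₀f : ∀ i → Small (f zero) (f (suc i))
      f₀f i = ff zero (suc i) λ ()
      go : ∀ i → p′ i ≡ + D′ * sgn σ → Balanced f S u v
      go zero tight = unshift₁ f σ
        (balance-from (f ∘ suc) (shift S u (sgn σ)) v (f zero) D′ (p′ (suc zero)) (p′ (suc (suc zero))) 0<D′
          (∣p′∣≤D′ (suc zero)) (∣p′∣≤D′ (suc (suc zero))) (absorb₁ (sgn σ) tight zs′) (vf zero) (vf ∘ suc) f₀f ff′)
      go (suc zero) tight = unshift₂ f σ
        (balance-from (f ∘ suc) (shift S v (sgn σ)) u (f zero) D′ (p′ zero) (p′ (suc (suc zero))) 0<D′
          (∣p′∣≤D′ zero) (∣p′∣≤D′ (suc (suc zero))) (absorb₁ (sgn σ) tight (rotate zs′)) (uf zero) (uf ∘ suc) f₀f ff′)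
      go (suc (suc zero)) tight = unshift₃ f σ
        (balance-from (f ∘ suc) (shift S (f zero) (sgn σ)) u v D′ (p′ zero) (p′ (suc zero)) 0<D′
          (∣p′∣≤D′ zero) (∣p′∣≤D′ (suc zero)) (absorb₃ (sgn σ) tight zs′) uv (uf ∘ suc) (vf ∘ suc) ff′)

    balance : ∀ {n} (f : Fin n → Plane) → (∀ i c → ∣ f i c ∣ ℕ.≤ A c) → (∀ i j → i ≢ j → Small (f i) (f j)) →
      ∃ λ (y : Fin n → Bool) → ∀ c → ∣ sumℤ (λ i → f i c * sgn (y i)) ∣ ℕ.≤ A c
    balance f single pair
      -- Two zero vectors with signs 0/1 form the initial live pair; a pair with a zero vector is
      -- small by the bound on single vectors.
      with balanced _ _ y small ← balance-from f (λ _ → + 0) (λ _ → + 0) (λ _ → + 0) 1 (+ 0) (+ 0) (s≤s z≤n) z≤n z≤n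
             (zeroSum₂ λ _ → refl) (λ _ → z≤n) single single pair
      = y , λ c → subst (λ x → ∣ x ∣ ℕ.≤ A c) (strip (sumℤ (λ i → f i c * sgn (y i)))) (small c)
      where
      strip : ∀ s → + 0 + (+ 0 + (+ 0 + s)) ≡ s
      strip = solve-∀

open Balancing
open import Data.Fin.Subset using (Subset; _∈_; _∉_; _⊆_; ⁅_⁆; _∪_; _∩_; _-_; _─_; ∣_∣) renaming (⊥ to ∅)
import Data.Fin.Subset.Properties as Sub

-- Membership tests and Booleans

memB-lookup : ∀ {n} (i : Fin n) S → memB i S ≡ lookup S i
memB-lookup i S with lookup S i
... | true  = refl
... | false = refl

∈⇒memB : ∀ {n} {i : Fin n} {S} → i ∈ S → memB i S ≡ true
∈⇒memB {i = i} {S} i∈S = trans (memB-lookup i S) ([]=⇒lookup i∈S)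

memB⇒∈ : ∀ {n} {i : Fin n} {S} → memB i S ≡ true → i ∈ S
memB⇒∈ {i = i} {S} eq = lookup⇒[]= i S (trans (sym (memB-lookup i S)) eq)

≢⇒≡not : ∀ {a b} → a ≢ b → a ≡ not b
≢⇒≡not {true}  {true}  a≢b = contradiction refl a≢b
≢⇒≡not {true}  {false} _   = refl
≢⇒≡not {false} {true}  _   = refl
≢⇒≡not {false} {false} a≢b = contradiction refl a≢b

not≢ : ∀ b → not b ≢ b
not≢ true  ()
not≢ false ()

-- Finite sums, counts and parities

module Sums where

  open import Data.Integer using (_+_; _*_; -_)
  open import Data.Integer.Tactic.RingSolver using (solve-∀)

  sumℤ-cong : ∀ {n} {f g : Fin n → ℤ} → (∀ i → f i ≡ g i) → sumℤ f ≡ sumℤ g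
  sumℤ-cong {zero}  _   = refl
  sumℤ-cong {suc n} f≗g = cong₂ _+_ (f≗g zero) (sumℤ-cong (f≗g ∘ suc))

  sumℤ-+ : ∀ {n} (f g : Fin n → ℤ) → sumℤ (λ i → f i + g i) ≡ sumℤ f + sumℤ g
  sumℤ-+ {zero}  f g = refl
  sumℤ-+ {suc n} f g = trans (cong (λ s → f zero + g zero + s) (sumℤ-+ (f ∘ suc) (g ∘ suc)))
                             (swap (f zero) (g zero) (sumℤ (f ∘ suc)) (sumℤ (g ∘ suc)))
    where
    swap : ∀ a b c d → a + b + (c + d) ≡ a + c + (b + d)
    swap = solve-∀

  sumℤ-neg : ∀ {n} (f : Fin n → ℤ) → sumℤ (λ i → - f i) ≡ - sumℤ f
  sumℤ-neg {zero}  f = refl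
  sumℤ-neg {suc n} f = trans (cong (λ s → - f zero + s) (sumℤ-neg (f ∘ suc))) (sym (ℤ.neg-distrib-+ (f zero) _))

  sumℤ-update : ∀ {n} (f g : Fin n → ℤ) d i → f i ≡ g i + d → (∀ k → k ≢ i → f k ≡ g k) → sumℤ f ≡ sumℤ g + d
  sumℤ-update f g d zero here elsewhere =
    trans (cong₂ _+_ here (sumℤ-cong (λ k → elsewhere (suc k) λ ()))) (swap (g zero) d (sumℤ (g ∘ suc)))
    where
    swap : ∀ a b c → a + b + c ≡ a + c + b
    swap = solve-∀
  sumℤ-update f g d (suc i) here elsewhere =
    trans (cong₂ _+_ (elsewhere zero λ ()) (sumℤ-update (f ∘ suc) (g ∘ suc) d i here (λ k k≢i → elsewhere (suc k) (k≢i ∘ Fin.suc-injective))))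
          (sym (ℤ.+-assoc (g zero) (sumℤ (g ∘ suc)) d))

open Sums

countB-cong : ∀ {n} {f g : Fin n → Bool} → (∀ i → f i ≡ g i) → countB f ≡ countB g
countB-cong {zero}  _   = refl
countB-cong {suc n} f≗g = cong₂ ℕ._+_ (cong (if_then 1 else 0) (f≗g zero)) (countB-cong (f≗g ∘ suc))

countB-pos : ∀ {n} {f : Fin n → Bool} i → f i ≡ true → 0 ℕ.< countB f
countB-pos {f = f} zero    fi rewrite fi = s≤s z≤n
countB-pos {f = f} (suc i) fi = ℕ.m≤n⇒m≤o+n (if f zero then 1 else 0) (countB-pos i fi)

xorB-cong : ∀ {n} {f g : Fin n → Bool} → (∀ i → f i ≡ g i) → xorB f ≡ xorB g
xorB-cong {zero}  _   = refl
xorB-cong {suc n} f≗g = cong₂ _xor_ (f≗g zero) (xorB-cong (f≗g ∘ suc))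

xorB-flip : ∀ {n} (f g : Fin n → Bool) i → f i ≡ not (g i) → (∀ k → k ≢ i → f k ≡ g k) → xorB f ≡ not (xorB g)
xorB-flip f g zero here elsewhere
  rewrite here | xorB-cong (λ k → elsewhere (suc k) λ ()) = sym (Bool.not-distribˡ-xor (g zero) _)
xorB-flip f g (suc i) here elsewhere
  rewrite elsewhere zero (λ ()) | xorB-flip (f ∘ suc) (g ∘ suc) i here (λ k k≢i → elsewhere (suc k) (k≢i ∘ Fin.suc-injective))
  = sym (Bool.not-distribʳ-xor (g zero) _)

-- Partial assignments

Partial : ℕ → Set
Partial n = Fin n → Maybe Bool

Fixed Free : ∀ {n} → Partial n → Fin n → Set
Fixed ρ i = ∃ λ b → ρ i ≡ just b
Free  ρ i = ρ i ≡ nothing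

infix 4 _⊑_
_⊑_ : ∀ {n} → Partial n → Partial n → Set
ρ ⊑ ρ′ = ∀ i b → ρ i ≡ just b → ρ′ i ≡ just b

⊑-trans : ∀ {n} {ρ₁ ρ₂ ρ₃ : Partial n} → ρ₁ ⊑ ρ₂ → ρ₂ ⊑ ρ₃ → ρ₁ ⊑ ρ₃
⊑-trans ρ₁⊑ρ₂ ρ₂⊑ρ₃ i b = ρ₂⊑ρ₃ i b ∘ ρ₁⊑ρ₂ i b

fixed⇒¬free : ∀ {n} (ρ : Partial n) {i} → Fixed ρ i → ¬ Free ρ i
fixed⇒¬free ρ (_ , fixed) free with () ← trans (sym fixed) free

fixed-or-free : ∀ {n} (ρ : Partial n) i → Fixed ρ i ⊎ Free ρ i
fixed-or-free ρ i with ρ i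
... | just b  = inj₁ (b , refl)
... | nothing = inj₂ refl

complete : ∀ {n} → Partial n → Assign n → Assign n
complete ρ y i = fromMaybe (y i) (ρ i)

complete-fixed : ∀ {n} (ρ : Partial n) y {i b} → ρ i ≡ just b → complete ρ y i ≡ b
complete-fixed ρ y eq rewrite eq = refl

complete-free : ∀ {n} (ρ : Partial n) y {i} → Free ρ i → complete ρ y i ≡ y i
complete-free ρ y eq rewrite eq = refl

⊑-complete : ∀ {n} (ρ : Partial n) y → ρ ⊑ just ∘ complete ρ y
⊑-complete ρ y i b eq = cong just (complete-fixed ρ y eq)

set : ∀ {n} → Partial n → Fin n → Bool → Partial n
set ρ i b = updateAt ρ i (const (just b))

set-here : ∀ {n} (ρ : Partial n) i b → set ρ i b i ≡ just b
set-here ρ i b = updateAt-updates i ρ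

set-elsewhere : ∀ {n} (ρ : Partial n) {i k} b → k ≢ i → set ρ i b k ≡ ρ k
set-elsewhere ρ {i} {k} b k≢i = updateAt-minimal k i ρ k≢i

⊑-set : ∀ {n} (ρ : Partial n) {i} b → Free ρ i → ρ ⊑ set ρ i b
⊑-set ρ {i} b free k c eq with k Fin.≟ i
... | yes refl = contradiction free (fixed⇒¬free ρ (c , eq))
... | no  k≢i  = trans (set-elsewhere ρ b k≢i) eq

fixed-set : ∀ {n} (ρ : Partial n) {i k} b → Fixed (set ρ i b) k → Fixed ρ k ⊎ k ≡ i
fixed-set ρ {i} {k} b (c , eq) with k Fin.≟ i
... | yes k≡i = inj₂ k≡i
... | no  k≢i = inj₁ (c , trans (sym (set-elsewhere ρ b k≢i)) eq)

-- Subcube centres and violated inequalities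

module Centres where

  open import Data.Integer using (_+_; _*_; -_; _≤_; _<_)
  open import Data.Integer.Tactic.RingSolver using (solve-∀)

  -- Twice the coordinate of the centre of the subcube of completions.
  doubled : Maybe Bool → ℤ
  doubled nothing  = + 1
  doubled (just b) = bit b + bit b

  centre : ∀ {n} → Ineq n → Partial n → ℤ
  centre I ρ = sumℤ (λ i → coef I i * doubled (ρ i))

  -- Strict failure at the centre of the subcube; both sides are doubled so that the half-integral
  -- centre stays within the integers.
  Violated : ∀ {n} → Partial n → Ineq n → Set
  Violated ρ I = centre I ρ < bound I + bound I

  violated-total : ∀ {n} (α : Assign n) I → Violated (just ∘ α) I → ¬ SatIneq α I
  violated-total α I violated sat = ℤ.<⇒≱ violated (begin
    bound I + bound I                          ≤⟨ ℤ.+-mono-≤ sat sat ⟩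
    sumℤ (λ i → coef I i * bit (α i)) + sumℤ (λ i → coef I i * bit (α i))
                                               ≡⟨ sumℤ-+ (λ i → coef I i * bit (α i)) _ ⟨
    sumℤ (λ i → coef I i * bit (α i) + coef I i * bit (α i))
                                               ≡⟨ sumℤ-cong (λ i → ℤ.*-distribˡ-+ (coef I i) (bit (α i)) (bit (α i))) ⟨
    centre I (just ∘ α)                        ∎)
    where open ℤ.≤-Reasoning

  total-violated : ∀ {n} (α : Assign n) I → ¬ SatIneq α I → Violated (just ∘ α) I
  total-violated α I ¬sat = begin-strict
    centre I (just ∘ α)                        ≡⟨ sumℤ-cong (λ i → ℤ.*-distribˡ-+ (coef I i) (bit (α i)) (bit (α i))) ⟩
    sumℤ (λ i → coef I i * bit (α i) + coef I i * bit (α i))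
                                               ≡⟨ sumℤ-+ (λ i → coef I i * bit (α i)) _ ⟩
    sumℤ (λ i → coef I i * bit (α i)) + sumℤ (λ i → coef I i * bit (α i))
                                               <⟨ ℤ.+-mono-< (ℤ.≰⇒> ¬sat) (ℤ.≰⇒> ¬sat) ⟩
    bound I + bound I                          ∎
    where open ℤ.≤-Reasoning

  record Midpoint {n} (ρ ρ₁ ρ₂ : Partial n) : Set where
    constructor midpoint
    field
      average : ∀ i → doubled (ρ₁ i) + doubled (ρ₂ i) ≡ doubled (ρ i) + doubled (ρ i)

  centre-midpoint : ∀ {n} I {ρ ρ₁ ρ₂ : Partial n} → Midpoint ρ ρ₁ ρ₂ → centre I ρ₁ + centre I ρ₂ ≡ centre I ρ + centre I ρ
  centre-midpoint I {ρ} {ρ₁} {ρ₂} (midpoint mid) = begin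
    centre I ρ₁ + centre I ρ₂  ≡⟨ join ρ₁ ρ₂ ⟨
    sumℤ (λ i → coef I i * (doubled (ρ₁ i) + doubled (ρ₂ i)))
                               ≡⟨ sumℤ-cong (λ i → cong (coef I i *_) (mid i)) ⟩
    sumℤ (λ i → coef I i * (doubled (ρ i) + doubled (ρ i)))
                               ≡⟨ join ρ ρ ⟩
    centre I ρ + centre I ρ    ∎
    where
    open ≡-Reasoning
    join : ∀ ρ ρ′ → sumℤ (λ i → coef I i * (doubled (ρ i) + doubled (ρ′ i))) ≡ centre I ρ + centre I ρ′
    join ρ ρ′ = trans (sumℤ-cong (λ i → ℤ.*-distribˡ-+ (coef I i) (doubled (ρ i)) (doubled (ρ′ i))))
                      (sumℤ-+ (λ i → coef I i * doubled (ρ i)) _)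

  -- A linear form at a midpoint is the average of its values at the two ends, so it cannot be below
  -- the threshold there while both ends reach it.
  violated-split : ∀ {n} I {ρ ρ₁ ρ₂ : Partial n} → Midpoint ρ ρ₁ ρ₂ → Violated ρ I → Violated ρ₁ I ⊎ Violated ρ₂ I
  violated-split I {ρ} {ρ₁} {ρ₂} mid violated
    with centre I ρ₁ ℤ.<? bound I + bound I | centre I ρ₂ ℤ.<? bound I + bound I
  ... | yes v | _     = inj₁ v
  ... | no  _ | yes v = inj₂ v
  ... | no ¬v | no ¬w = contradiction (ℤ.+-mono-< violated violated)
    (ℤ.≤⇒≯ (ℤ.≤-trans (ℤ.+-mono-≤ (ℤ.≮⇒≥ ¬v) (ℤ.≮⇒≥ ¬w)) (ℤ.≤-reflexive (centre-midpoint I mid))))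

  violated-midpoint : ∀ {n} I {ρ ρ₁ ρ₂ : Partial n} → Midpoint ρ ρ₁ ρ₂ → Violated ρ₁ I → Violated ρ₂ I → Violated ρ I
  violated-midpoint I {ρ} mid v₁ v₂ with centre I ρ ℤ.<? bound I + bound I
  ... | yes v = v
  ... | no ¬v = contradiction (ℤ.+-mono-< v₁ v₂)
    (ℤ.≤⇒≯ (ℤ.≤-trans (ℤ.+-mono-≤ (ℤ.≮⇒≥ ¬v) (ℤ.≮⇒≥ ¬v)) (ℤ.≤-reflexive (sym (centre-midpoint I mid)))))

  doubled-antipodal : ∀ b → doubled (just b) + doubled (just (not b)) ≡ + 2
  doubled-antipodal true  = refl
  doubled-antipodal false = refl

  midpoint-complete : ∀ {n} (ρ : Partial n) y → Midpoint ρ (just ∘ complete ρ y) (just ∘ complete ρ (not ∘ y))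
  midpoint-complete ρ y = midpoint λ i → go i
    where
    go : ∀ i → doubled (just (complete ρ y i)) + doubled (just (complete ρ (not ∘ y) i)) ≡ doubled (ρ i) + doubled (ρ i)
    go i with ρ i
    ... | just _  = refl
    ... | nothing = doubled-antipodal (y i)

  midpoint-set : ∀ {n} (ρ : Partial n) {i} b → Free ρ i → Midpoint ρ (set ρ i b) (set ρ i (not b))
  midpoint-set ρ {i} b free = midpoint go
    where
    go : ∀ k → doubled (set ρ i b k) + doubled (set ρ i (not b) k) ≡ doubled (ρ k) + doubled (ρ k)
    go k with k Fin.≟ i
    ... | yes refl rewrite set-here ρ i b | set-here ρ i (not b) | free = doubled-antipodal b
    ... | no  k≢i  rewrite set-elsewhere ρ b k≢i | set-elsewhere ρ (not b) k≢i = refl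

  midpoint-set₂ : ∀ {n} (ρ : Partial n) {i j} b c → Free ρ i → Free ρ j →
                  Midpoint ρ (set (set ρ i b) j c) (set (set ρ i (not b)) j (not c))
  midpoint-set₂ ρ {i} {j} b c freeᵢ freeⱼ = midpoint go
    where
    go : ∀ k → doubled (set (set ρ i b) j c k) + doubled (set (set ρ i (not b)) j (not c) k) ≡ doubled (ρ k) + doubled (ρ k)
    go k with k Fin.≟ j
    ... | yes refl rewrite set-here (set ρ i b) j c | set-here (set ρ i (not b)) j (not c) | freeⱼ = doubled-antipodal c
    ... | no  k≢j  rewrite set-elsewhere (set ρ i b) c k≢j | set-elsewhere (set ρ i (not b)) (not c) k≢j = Midpoint.average (midpoint-set ρ b freeᵢ) k

  -- The centre of the subcube is the midpoint of any two antipodal completions.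
  falsified : ∀ {n} I (ρ : Partial n) y → Violated ρ I → ¬ SatIneq (complete ρ y) I ⊎ ¬ SatIneq (complete ρ (not ∘ y)) I
  falsified I ρ y violated with violated-split I (midpoint-complete ρ y) violated
  ... | inj₁ v = inj₁ (violated-total (complete ρ y) I v)
  ... | inj₂ v = inj₂ (violated-total (complete ρ (not ∘ y)) I v)

  -- The all-true and all-false assignments both falsify `I`, and their midpoint is the centre of
  -- the whole cube.
  unsat⇒violated : ∀ {n} (I : Ineq n) → (∀ α → ¬ SatIneq α I) → Violated (const nothing) I
  unsat⇒violated I unsat = violated-midpoint I (midpoint-complete (const nothing) (const true))
    (total-violated (const true) I (unsat (const true))) (total-violated (const false) I (unsat (const false)))

  centre-set : ∀ {n} I (ρ : Partial n) {i} b → Free ρ i → centre I (set ρ i b) ≡ centre I ρ + coef I i * sgn b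
  centre-set I ρ {i} b free = sumℤ-update _ _ _ i atI λ k k≢i → cong (λ m → coef I k * doubled m) (set-elsewhere ρ b k≢i)
    where
    distrib : ∀ b → coef I i * doubled (just b) ≡ coef I i * + 1 + coef I i * sgn b
    distrib true  = ℤ.*-distribˡ-+ (coef I i) (+ 1) (+ 1)
    distrib false = ℤ.*-distribˡ-+ (coef I i) (+ 1) (- + 1)
    atI : coef I i * doubled (set ρ i b i) ≡ coef I i * doubled (ρ i) + coef I i * sgn b
    atI rewrite set-here ρ i b | free = distrib b

  -- Zero on fixed variables, so that a sum over all variables only sees the free ones.
  freeCoef : ∀ {n} → Partial n → Ineq n → Fin n → ℤ
  freeCoef ρ I i with ρ i
  ... | just _  = + 0
  ... | nothing = coef I i

  freeCoef-free : ∀ {n} (ρ : Partial n) I {i} → Free ρ i → freeCoef ρ I i ≡ coef I i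
  freeCoef-free ρ I {i} free with ρ i
  freeCoef-free ρ I {i} refl | nothing = refl

  freeCoef-fixed : ∀ {n} (ρ : Partial n) I {i} → Fixed ρ i → freeCoef ρ I i ≡ + 0
  freeCoef-fixed ρ I {i} fixed with ρ i
  freeCoef-fixed ρ I {i} (_ , refl) | just _ = refl

  -- A free variable moves from doubled coordinate 1 to 2 or 0, which is a shift by its sign; a
  -- fixed variable does not move.
  centre-complete : ∀ {n} I (ρ : Partial n) y → centre I (just ∘ complete ρ y) ≡ centre I ρ + sumℤ (λ i → freeCoef ρ I i * sgn (y i))
  centre-complete I ρ y = trans (sumℤ-cong pointwise) (sumℤ-+ (λ i → coef I i * doubled (ρ i)) _)
    where
    distrib : ∀ a b → a * doubled (just b) ≡ a * + 1 + a * sgn b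
    distrib a true  = ℤ.*-distribˡ-+ a (+ 1) (+ 1)
    distrib a false = ℤ.*-distribˡ-+ a (+ 1) (- + 1)
    pointwise : ∀ i → coef I i * doubled (just (complete ρ y i)) ≡ coef I i * doubled (ρ i) + freeCoef ρ I i * sgn (y i)
    pointwise i with ρ i
    ... | just b  = sym (ℤ.+-identityʳ (coef I i * (bit b + bit b)))
    ... | nothing = distrib (coef I i) (y i)

  negSign : ∀ a → ∃ λ b → a * sgn b ≡ - (+ ℤ.∣ a ∣)
  negSign (+ n)      = false , trans (sym (ℤ.neg-distribʳ-* (+ n) (+ 1))) (cong -_ (ℤ.*-identityʳ (+ n)))
  negSign (-[1+ n ]) = true , ℤ.*-identityʳ -[1+ n ]

open Centres

-- From a violated conclusion to a violated premise

module Queries where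

  open import Data.Integer using (_+_; _*_; -_; _≤_; _<_)
  open import Data.Integer.Tactic.RingSolver using (solve-∀)

  FixedWithin : ∀ {n} → Partial n → Subset n → Partial n → Set
  FixedWithin ρ N ρ′ = ∀ i → Fixed ρ′ i → Fixed ρ i ⊎ i ∈ N

  record Query {n} (ρ : Partial n) (I : Ineq n) : Set where
    constructor query
    field
      after       : Partial n
      queried     : Subset n
      violated    : Violated after I
      extends     : ρ ⊑ after
      ∣queried∣≤2 : ∣ queried ∣ ℕ.≤ 2
      fixedWithin : FixedWithin ρ queried after

  infix 4 _has-slack_at_
  -- Since `A` is a natural number, this says that `I` is not violated and measures by how much.
  _has-slack_at_ : ∀ {n} → Ineq n → ℕ → Partial n → Set
  I has-slack A at ρ = centre I ρ ≡ bound I + bound I + + A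

  below : ∀ B {A m} → A ℕ.< m → B + + A + - + m < B
  below B {A} {m} A<m = begin-strict
    B + + A + - + m    ≡⟨ ℤ.+-assoc B (+ A) (- + m) ⟩
    B + (+ A + - + m)  <⟨ ℤ.+-monoʳ-< B (ℤ.+-monoˡ-< (- + m) (ℤ.+<+ A<m)) ⟩
    B + (+ m + - + m)  ≡⟨ cong (λ x → B + x) (ℤ.+-inverseʳ (+ m)) ⟩
    B + + 0            ≡⟨ ℤ.+-identityʳ B ⟩
    B                  ∎
    where open ℤ.≤-Reasoning

  -- Giving `i` the value that opposes its coefficient lowers the doubled centre by `∣ coef I i ∣`,
  -- which exceeds the slack.
  query₁ : ∀ {n} (ρ : Partial n) I {A} i → I has-slack A at ρ → Free ρ i → A ℕ.< ℤ.∣ coef I i ∣ → Query ρ I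
  query₁ ρ I {A} i slack free A<a with b , b≡ ← negSign (coef I i) =
    query (set ρ i b) ⁅ i ⁆
      (subst (_< bound I + bound I) (sym (trans (centre-set I ρ b free) (cong₂ _+_ slack b≡))) (below (bound I + bound I) A<a))
      (⊑-set ρ b free)
      (ℕ.≤-trans (ℕ.≤-reflexive (Sub.∣⁅x⁆∣≡1 i)) (s≤s z≤n))
      within
    where
    within : FixedWithin ρ ⁅ i ⁆ (set ρ i b)
    within k fixed with fixed-set ρ b fixed
    ... | inj₁ f    = inj₁ f
    ... | inj₂ refl = inj₂ (Sub.x∈⁅x⁆ i)

  ∣p∪q∣≤∣p∣+∣q∣ : ∀ {n} (p q : Subset n) → ∣ p ∪ q ∣ ℕ.≤ ∣ p ∣ ℕ.+ ∣ q ∣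
  ∣p∪q∣≤∣p∣+∣q∣ [] [] = z≤n
  ∣p∪q∣≤∣p∣+∣q∣ (false ∷ p) (false ∷ q) = ∣p∪q∣≤∣p∣+∣q∣ p q
  ∣p∪q∣≤∣p∣+∣q∣ (false ∷ p) (true  ∷ q) = subst (suc ∣ p ∪ q ∣ ℕ.≤_) (sym (ℕ.+-suc ∣ p ∣ ∣ q ∣)) (s≤s (∣p∪q∣≤∣p∣+∣q∣ p q))
  ∣p∪q∣≤∣p∣+∣q∣ (true  ∷ p) (false ∷ q) = s≤s (∣p∪q∣≤∣p∣+∣q∣ p q)
  ∣p∪q∣≤∣p∣+∣q∣ (true  ∷ p) (true  ∷ q) = s≤s (ℕ.≤-trans (∣p∪q∣≤∣p∣+∣q∣ p q) (ℕ.+-monoʳ-≤ ∣ p ∣ (ℕ.n≤1+n ∣ q ∣)))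

  query₂ : ∀ {n} (ρ : Partial n) I {A} i j → i ≢ j → I has-slack A at ρ → Free ρ i → Free ρ j →
           A ℕ.< ℤ.∣ coef I i ∣ ℕ.+ ℤ.∣ coef I j ∣ → Query ρ I
  query₂ ρ I {A} i j i≢j slack freeᵢ freeⱼ A<a
    with b , b≡ ← negSign (coef I i) | c , c≡ ← negSign (coef I j) =
    query (set (set ρ i b) j c) (⁅ i ⁆ ∪ ⁅ j ⁆)
      (subst (_< bound I + bound I) (sym (centre≡ b c b≡ c≡)) (below (bound I + bound I) A<a))
      (⊑-trans (⊑-set ρ b freeᵢ) (⊑-set (set ρ i b) c (freeⱼ′ b)))
      (subst₂ (λ x y → ∣ ⁅ i ⁆ ∪ ⁅ j ⁆ ∣ ℕ.≤ x ℕ.+ y) (Sub.∣⁅x⁆∣≡1 i) (Sub.∣⁅x⁆∣≡1 j) (∣p∪q∣≤∣p∣+∣q∣ ⁅ i ⁆ ⁅ j ⁆))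
      (within b c)
    where
    freeⱼ′ : ∀ b → Free (set ρ i b) j
    freeⱼ′ b = trans (set-elsewhere ρ b (i≢j ∘ sym)) freeⱼ
    centre≡ : ∀ b c → coef I i * sgn b ≡ - + ℤ.∣ coef I i ∣ → coef I j * sgn c ≡ - + ℤ.∣ coef I j ∣ →
      centre I (set (set ρ i b) j c) ≡ bound I + bound I + + A + - + (ℤ.∣ coef I i ∣ ℕ.+ ℤ.∣ coef I j ∣)
    centre≡ b c b≡ c≡ = begin
      centre I (set (set ρ i b) j c)
        ≡⟨ centre-set I (set ρ i b) c (freeⱼ′ b) ⟩
      centre I (set ρ i b) + coef I j * sgn c
        ≡⟨ cong₂ _+_ (trans (centre-set I ρ b freeᵢ) (cong₂ _+_ slack b≡)) c≡ ⟩
      bound I + bound I + + A + - + ℤ.∣ coef I i ∣ + - + ℤ.∣ coef I j ∣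
        ≡⟨ ℤ.+-assoc (bound I + bound I + + A) (- + ℤ.∣ coef I i ∣) (- + ℤ.∣ coef I j ∣) ⟩
      bound I + bound I + + A + (- + ℤ.∣ coef I i ∣ + - + ℤ.∣ coef I j ∣)
        ≡⟨ cong (λ x → bound I + bound I + + A + x) (ℤ.neg-distrib-+ (+ ℤ.∣ coef I i ∣) (+ ℤ.∣ coef I j ∣)) ⟨
      bound I + bound I + + A + - + (ℤ.∣ coef I i ∣ ℕ.+ ℤ.∣ coef I j ∣)
        ∎
      where open ≡-Reasoning
    within : ∀ b c → FixedWithin ρ (⁅ i ⁆ ∪ ⁅ j ⁆) (set (set ρ i b) j c)
    within b c k fixed with fixed-set (set ρ i b) c fixed
    ... | inj₂ refl = inj₂ (Sub.x∈p∪q⁺ (inj₂ (Sub.x∈⁅x⁆ j)))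
    ... | inj₁ fixed′ with fixed-set ρ b fixed′
    ...   | inj₂ refl = inj₂ (Sub.x∈p∪q⁺ (inj₁ (Sub.x∈⁅x⁆ i)))
    ...   | inj₁ f    = inj₁ f

  query₀ : ∀ {n} (ρ : Partial n) I → Violated ρ I → Query ρ I
  query₀ {n} ρ I violated = query ρ ∅ violated (λ _ _ eq → eq) (ℕ.≤-trans (ℕ.≤-reflexive (Sub.∣⊥∣≡0 n)) z≤n) (λ _ → inj₁)

  slack : ∀ {n} (ρ : Partial n) I → ¬ Violated ρ I → ∃ λ A → I has-slack A at ρ
  slack ρ I ¬violated = ℤ.∣ centre I ρ ℤ.- B ∣ , (begin
    centre I ρ                        ≡⟨ lemma (centre I ρ) B ⟩
    B + (centre I ρ ℤ.- B)            ≡⟨ cong (λ x → B + x) (ℤ.0≤i⇒+∣i∣≡i (ℤ.i≤j⇒0≤j-i (ℤ.≮⇒≥ ¬violated))) ⟨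
    B + + ℤ.∣ centre I ρ ℤ.- B ∣      ∎)
    where
    open ≡-Reasoning
    B = bound I + bound I
    lemma : ∀ c B → c ≡ B + (c ℤ.- B)
    lemma = solve-∀

  -- Passing from the centre to the completion changes the doubled value by the signed sum of free
  -- coefficients; a change of at most the slack cannot take it below the bound.
  balanced⇒sat : ∀ {n} (ρ : Partial n) I {A} y → I has-slack A at ρ →
    ℤ.∣ sumℤ (λ i → freeCoef ρ I i * sgn (y i)) ∣ ℕ.≤ A → SatIneq (complete ρ y) I
  balanced⇒sat ρ I {A} y slack ∣s∣≤A with bound I ℤ.≤? sumℤ (λ i → coef I i * bit (complete ρ y i))
  ... | yes sat  = sat
  ... | no  ¬sat = contradiction (total-violated (complete ρ y) I ¬sat) (ℤ.≤⇒≯ (begin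
    B                                  ≡⟨ lemma B (+ A) ⟩
    B + + A + - + A                    ≤⟨ ℤ.+-monoʳ-≤ (B + + A) (ℤ.neg-mono-≤ (≤-abs { - s} (subst (ℕ._≤ A) (sym (ℤ.∣-i∣≡∣i∣ s)) ∣s∣≤A))) ⟩
    B + + A + - - s                    ≡⟨ cong₂ _+_ (sym slack) (ℤ.neg-involutive s) ⟩
    centre I ρ + s                     ≡⟨ centre-complete I ρ y ⟨
    centre I (just ∘ complete ρ y)     ∎))
    where
    open ℤ.≤-Reasoning
    B = bound I + bound I
    s = sumℤ (λ i → freeCoef ρ I i * sgn (y i))
    lemma : ∀ B A → B ≡ B + A + - A
    lemma = solve-∀

  sum-antipodal : ∀ {n} (a : Fin n → ℤ) (y : Assign n) → sumℤ (λ i → a i * sgn (not (y i))) ≡ - sumℤ (λ i → a i * sgn (y i))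
  sum-antipodal a y = trans (sumℤ-cong (λ i → pointwise (a i) (y i))) (sumℤ-neg (λ i → a i * sgn (y i)))
    where
    pointwise : ∀ a b → a * sgn (not b) ≡ - (a * sgn b)
    pointwise a true  = sym (ℤ.neg-distribʳ-* a (+ 1))
    pointwise a false = sym (ℤ.neg-distribʳ-* a (- + 1))

  -- Either a premise is already violated, or one or two free coefficients of a premise exceed its
  -- slack and fixing those variables violates it, or the hypotheses of `balance` hold and its
  -- signing contradicts soundness of the rule.
  violatePremise : ∀ {n} (I : Fin 2 → Ineq n) J ρ → (∀ α → (∀ c → SatIneq α (I c)) → SatIneq α J) →
    Violated ρ J → ∃ λ c → Query ρ (I c)
  violatePremise {n} I J ρ I⇒J violated
    with Fin.any? (λ c → centre (I c) ρ ℤ.<? bound (I c) + bound (I c))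
  ... | yes (c , v) = c , query₀ ρ (I c) v
  ... | no ¬v = balanceOrQuery
    where
    A : Fin 2 → ℕ
    A c = proj₁ (slack ρ (I c) (λ v → ¬v (c , v)))
    slacks : ∀ c → I c has-slack A c at ρ
    slacks c = proj₂ (slack ρ (I c) (λ v → ¬v (c , v)))
    -- The coefficients of one variable in the two premises form a plane vector, and the two slacks
    -- bound the coordinates.
    f : Fin n → Plane
    f i c = freeCoef ρ (I c) i
    balanceOrQuery : ∃ λ c → Query ρ (I c)
    balanceOrQuery with Fin.any? (λ i → Fin.any? λ c → A c ℕ.<? ℤ.∣ f i c ∣)
    ... | yes (i , c , A<f) with fixed-or-free ρ i
    ...   | inj₁ fixed = contradiction (subst (λ a → A c ℕ.< ℤ.∣ a ∣) (freeCoef-fixed ρ (I c) fixed) A<f) ℕ.n≮0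
    ...   | inj₂ free  = c , query₁ ρ (I c) i (slacks c) free (subst (λ a → A c ℕ.< ℤ.∣ a ∣) (freeCoef-free ρ (I c) free) A<f)
    balanceOrQuery | no ¬single
      with Fin.any? (λ i → Fin.any? λ j → Fin.any? λ c → ¬? (i Fin.≟ j) ×-dec A c ℕ.<? ℤ.∣ f i c ∣ ℕ.+ ℤ.∣ f j c ∣)
    ... | yes (i , j , c , i≢j , A<f) with fixed-or-free ρ i | fixed-or-free ρ j
    -- A fixed variable has free coefficient 0, so the other variable alone would exceed the slack.
    ...   | inj₁ fixed | _ = contradiction (j , c , subst (λ a → A c ℕ.< ℤ.∣ a ∣ ℕ.+ ℤ.∣ f j c ∣) (freeCoef-fixed ρ (I c) fixed) A<f) ¬single
    ...   | inj₂ _ | inj₁ fixed = contradiction (i , c , subst (A c ℕ.<_) (trans (cong (λ a → ℤ.∣ f i c ∣ ℕ.+ ℤ.∣ a ∣) (freeCoef-fixed ρ (I c) fixed)) (ℕ.+-identityʳ ℤ.∣ f i c ∣)) A<f) ¬single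
    ...   | inj₂ freeᵢ | inj₂ freeⱼ = c , query₂ ρ (I c) i j i≢j (slacks c) freeᵢ freeⱼ
              (subst₂ (λ a b → A c ℕ.< ℤ.∣ a ∣ ℕ.+ ℤ.∣ b ∣) (freeCoef-free ρ (I c) freeᵢ) (freeCoef-free ρ (I c) freeⱼ) A<f)
    balanceOrQuery | no ¬single | no ¬pair
      with y , small ← balance A f (λ i c → ℕ.≮⇒≥ λ lt → ¬single (i , c , lt))
                               (λ i j i≢j c → ℕ.≮⇒≥ λ lt → ¬pair (i , j , c , i≢j , lt))
      -- The balanced signing and its negation have sums of equal absolute value, so both
      -- completions satisfy both premises; yet one of them falsifies `J`.
      with falsified J ρ y violated
    ... | inj₁ ¬sat = contradiction (I⇒J _ λ c → balanced⇒sat ρ (I c) y (slacks c) (small c)) ¬sat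
    ... | inj₂ ¬sat = contradiction (I⇒J _ λ c → balanced⇒sat ρ (I c) (not ∘ y) (slacks c)
              (subst (ℕ._≤ A c) (trans (sym (ℤ.∣-i∣≡∣i∣ (sumℤ (λ i → f i c * sgn (y i))))) (cong ℤ.∣_∣ (sym (sum-antipodal (λ i → f i c) y)))) (small c))) ¬sat

open Queries
open Queries

x∈p─q⇒x∉q : ∀ {n} {x : Fin n} (p q : Subset n) → x ∈ p ─ q → x ∉ q
x∈p─q⇒x∉q {x = suc _} (_ ∷ p) (_ ∷ q) (Vec.there x∈) (Vec.there x∈q) = x∈p─q⇒x∉q p q x∈ x∈q
x∈p─q⇒x∉q {x = zero} (false ∷ p) (true ∷ q) () _
x∈p─q⇒x∉q {x = zero} (true ∷ p) (true ∷ q) () _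

-- Clauses, solved equations and fixing an equation

module Clauses {n m} (F : System n m) where

  open import Data.Integer using (_+_; _*_; -_; _≤_)
  open import Data.Integer.Tactic.RingSolver using (solve-∀)

  -- With the constant returned from the bound, each occurring variable contributes `α i` or
  -- `1 - α i` according to `β i`. The total counts the disagreements of `α` and `β`, so the clause
  -- demands at least one.
  clauseSum : ∀ {k} (occurs : Fin k → Bool) (α β : Assign k) →
    sumℤ (λ i → (if occurs i then (if β i then - (+ 1) else + 1) else + 0) * bit (α i)) + + countB (λ i → occurs i ∧ β i)
    ≡ + countB (λ i → occurs i ∧ (α i xor β i))
  clauseSum {zero}  _      _ _ = refl
  clauseSum {suc k} occurs α β = begin
    head + tail + (+ h + + t)            ≡⟨ swap head tail (+ h) (+ t) ⟩
    (head + + h) + (tail + + t)          ≡⟨ cong₂ _+_ (pointwise (occurs zero) (α zero) (β zero)) (clauseSum (occurs ∘ suc) (α ∘ suc) (β ∘ suc)) ⟩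
    + countB (λ i → occurs i ∧ (α i xor β i)) ∎
    where
    open ≡-Reasoning
    head = (if occurs zero then (if β zero then - (+ 1) else + 1) else + 0) * bit (α zero)
    tail = sumℤ (λ i → (if occurs (suc i) then (if β (suc i) then - (+ 1) else + 1) else + 0) * bit (α (suc i)))
    h = if occurs zero ∧ β zero then 1 else 0
    t = countB (λ i → occurs (suc i) ∧ β (suc i))
    swap : ∀ a b c d → a + b + (c + d) ≡ (a + c) + (b + d)
    swap = solve-∀
    pointwise : ∀ o a b → (if o then (if b then - (+ 1) else + 1) else + 0) * bit a + + (if o ∧ b then 1 else 0)
                        ≡ + (if o ∧ (a xor b) then 1 else 0)
    pointwise true  true  true  = refl
    pointwise true  true  false = refl
    pointwise true  false true  = refl
    pointwise true  false false = refl
    pointwise false true  _     = refl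
    pointwise false false _     = refl

  clause-sat : ∀ {j i} α β → i ∈ vars F j → α i ≢ β i → SatIneq α (clauseIneq F j β)
  clause-sat {j} {i} α β i∈j αi≢βi = begin
    + 1 + - (+ c)        ≤⟨ ℤ.+-monoˡ-≤ (- (+ c)) (+≤+ (countB-pos i differs)) ⟩
    + d + - (+ c)        ≡⟨ cong (λ x → x + - (+ c)) (clauseSum (λ i → memB i (vars F j)) α β) ⟨
    s + + c + - (+ c)    ≡⟨ lemma s (+ c) ⟩
    s                    ∎
    where
    open ℤ.≤-Reasoning
    c = countB (λ i → memB i (vars F j) ∧ β i)
    d = countB (λ i → memB i (vars F j) ∧ (α i xor β i))
    s = sumℤ (λ i → coef (clauseIneq F j β) i * bit (α i))
    lemma : ∀ s c → s + c + - c ≡ s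
    lemma = solve-∀
    xor-≢ : ∀ a b → a ≢ b → a xor b ≡ true
    xor-≢ a b a≢b rewrite ≢⇒≡not a≢b = trans (sym (Bool.not-distribˡ-xor b b)) (cong not (Bool.xor-same b))
    differs : memB i (vars F j) ∧ (α i xor β i) ≡ true
    differs rewrite ∈⇒memB i∈j = xor-≢ (α i) (β i) αi≢βi

  SatEq-cong : ∀ j {α β} → (∀ {i} → i ∈ vars F j → α i ≡ β i) → SatEq F j α → SatEq F j β
  SatEq-cong j {α} {β} α≗β sat = trans (sym (xorB-cong pointwise)) sat
    where
    pointwise : ∀ i → memB i (vars F j) ∧ α i ≡ memB i (vars F j) ∧ β i
    pointwise i with memB i (vars F j) in eq
    ... | true  = α≗β (memB⇒∈ eq)
    ... | false = refl

  Solves : Partial n → Fin m → Set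
  Solves ρ j = ∀ α → ρ ⊑ just ∘ α → SatEq F j α

  -- An assignment falsifying the clause of `β` agrees with `β` on all variables of the equation.
  falsified-clause : ∀ {j} α β → ¬ SatIneq α (clauseIneq F j β) → SatEq F j α → SatEq F j β
  falsified-clause {j} α β ¬c = SatEq-cong j λ {i} i∈j → equal i i∈j
    where
    equal : ∀ i → i ∈ vars F j → α i ≡ β i
    equal i i∈j with α i Bool.≟ β i
    ... | yes eq = eq
    ... | no  ne = contradiction (clause-sat α β i∈j ne) ¬c

  -- A violated clause is falsified by some completion; that completion satisfies the equation and
  -- agrees with `β` on it, but `β` does not satisfy it.
  solved⇒¬violated : ∀ ρ j β → Solves ρ j → ¬ SatEq F j β → ¬ Violated ρ (clauseIneq F j β)
  solved⇒¬violated ρ j β solves ¬sat violated with falsified (clauseIneq F j β) ρ β violated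
  ... | inj₁ ¬c = ¬sat (falsified-clause (complete ρ β) β ¬c (solves _ (⊑-complete ρ β)))
  ... | inj₂ ¬c = ¬sat (falsified-clause (complete ρ (not ∘ β)) β ¬c (solves _ (⊑-complete ρ (not ∘ β))))

  record TwoFree (ρ : Partial n) (j : Fin m) : Set where
    constructor twoFree
    field
      {u v} : Fin n
      u∈j   : u ∈ vars F j
      v∈j   : v ∈ vars F j
      u≢v   : u ≢ v
      freeᵤ : Free ρ u
      freeᵥ : Free ρ v

  -- Complete ρ so that u satisfies the clause; the antipodal completion satisfies it through v.
  twoFree⇒¬violated : ∀ ρ j β → TwoFree ρ j → ¬ Violated ρ (clauseIneq F j β)
  twoFree⇒¬violated ρ j β (twoFree {u} {v} u∈j v∈j u≢v freeᵤ freeᵥ) violated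
    with falsified (clauseIneq F j β) ρ (updateAt β u not) violated
  ... | inj₁ ¬c = ¬c (clause-sat (complete ρ (updateAt β u not)) β u∈j λ eq →
          not≢ (β u) (trans (sym (trans (complete-free ρ (updateAt β u not) freeᵤ) (updateAt-updates u {not} β))) eq))
  ... | inj₂ ¬c = ¬c (clause-sat (complete ρ (not ∘ updateAt β u not)) β v∈j λ eq →
          not≢ (β v) (trans (sym (trans (complete-free ρ (not ∘ updateAt β u not) freeᵥ) (cong not (updateAt-minimal v u {not} β (u≢v ∘ sym))))) eq))

  record Extension (ρ : Partial n) (I : Ineq n) (N : Subset n) : Set where
    constructor extension
    field
      after       : Partial n
      violated    : Violated after I
      extends     : ρ ⊑ after
      fixedWithin : FixedWithin ρ N after

  -- The centre of `ρ′` is the midpoint of the centres for the two values of a free variable, so one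
  -- of the values keeps `I` violated.
  fixList : ∀ I (N : Subset n) (is : List (Fin n)) ρ → Violated ρ I →
    ∃ λ (e : Extension ρ I N) → ∀ {i} → i ∈ᴸ is → i ∈ N → Fixed (Extension.after e) i
  fixList I N [] ρ violated = extension ρ violated (λ _ _ eq → eq) (λ _ → inj₁) , λ ()
  fixList I N (i ∷ is) ρ violated
    with extension ρ′ violated′ extends within , fixed ← fixList I N is ρ violated
    with fixed-or-free ρ′ i | i Sub.∈? N
  ... | inj₁ fixedᵢ | _       = extension ρ′ violated′ extends within , λ { (Any.here refl) _ → fixedᵢ ; (Any.there k∈is) → fixed k∈is }
  ... | inj₂ _      | no i∉N  = extension ρ′ violated′ extends within , λ { (Any.here refl) i∈N → contradiction i∈N i∉N ; (Any.there k∈is) → fixed k∈is }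
  ... | inj₂ free   | yes i∈N = result (violated-split I (midpoint-set ρ′ true free) violated′)
    where
    setTo : ∀ b → Violated (set ρ′ i b) I → ∃ λ (e : Extension ρ I N) → ∀ {k} → k ∈ᴸ i ∷ is → k ∈ N → Fixed (Extension.after e) k
    setTo b v = extension (set ρ′ i b) v (⊑-trans extends (⊑-set ρ′ b free)) within′
              , λ { (Any.here refl) _ → b , set-here ρ′ i b
                  ; {k} (Any.there k∈is) k∈N → let c , eq = fixed k∈is k∈N in c , ⊑-set ρ′ b free k c eq }
      where
      within′ : FixedWithin ρ N (set ρ′ i b)
      within′ k f with fixed-set ρ′ b f
      ... | inj₁ f′   = within k f′
      ... | inj₂ refl = inj₂ i∈N
    result : Violated (set ρ′ i true) I ⊎ Violated (set ρ′ i false) I → ∃ λ (e : Extension ρ I N) → ∀ {k} → k ∈ᴸ i ∷ is → k ∈ N → Fixed (Extension.after e) k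
    result (inj₁ v) = setTo true v
    result (inj₂ v) = setTo false v

  -- All variables but two are fixed one by one, keeping I violated; the two
  -- solutions for the remaining pair are antipodal, so one of them keeps I violated.
  fixEquation : ∀ I ρ j → Violated ρ I → TwoFree ρ j → ∃ λ (e : Extension ρ I (vars F j)) → Solves (Extension.after e) j
  fixEquation I ρ j violated (twoFree {u} {v} u∈j v∈j u≢v freeᵤ freeᵥ)
    with extension ρ₁ violated₁ extends₁ within₁ , fixed₁ ← fixList I (vars F j - u - v) (allFin n) ρ violated
    = result (violated-split I (midpoint-set₂ ρ₁ false c free₁ᵤ free₁ᵥ) violated₁)
    where
    u∉ : u ∉ vars F j - u - v
    u∉ u∈ = x∈p─q⇒x∉q _ _ (Sub.p─q⊆p _ _ u∈) (Sub.x∈⁅x⁆ u)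
    v∉ : v ∉ vars F j - u - v
    v∉ v∈ = x∈p─q⇒x∉q _ _ v∈ (Sub.x∈⁅x⁆ v)
    stillFree : ∀ {i} → i ∉ vars F j - u - v → Free ρ i → Free ρ₁ i
    stillFree {i} i∉ free with fixed-or-free ρ₁ i
    ... | inj₂ free₁ = free₁
    ... | inj₁ fixed with within₁ i fixed
    ...   | inj₁ f  = contradiction free (fixed⇒¬free ρ f)
    ...   | inj₂ i∈ = contradiction i∈ i∉
    free₁ᵤ : Free ρ₁ u
    free₁ᵤ = stillFree u∉ freeᵤ
    free₁ᵥ : Free ρ₁ v
    free₁ᵥ = stillFree v∉ freeᵥ
    ρ₂ : Bool → Bool → Partial n
    ρ₂ a b = set (set ρ₁ u a) v b
    -- The default `false` is seen only outside `vars F j`, since `ρ₂` fixes every variable of the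
    -- equation.
    α₂ : Bool → Bool → Assign n
    α₂ a b = complete (ρ₂ a b) (const false)
    parity : Bool → Bool → Bool
    parity a b = xorB (λ i → memB i (vars F j) ∧ α₂ a b i)
    -- The value of `v` that corrects the parity when `u` is false: it is true exactly if the parity
    -- with both false is wrong.
    c : Bool
    c = parity false false xor rhs F j
    α₂-v : ∀ a b → α₂ a b v ≡ b
    α₂-v a b = complete-fixed (ρ₂ a b) (const false) (set-here (set ρ₁ u a) v b)
    flip-v : ∀ a b → parity a (not b) ≡ not (parity a b)
    flip-v a b = xorB-flip (λ i → memB i (vars F j) ∧ α₂ a (not b) i) (λ i → memB i (vars F j) ∧ α₂ a b i) v
      here λ k k≢v → cong (memB k (vars F j) ∧_) (elsewhere k k≢v)
      where
      here : memB v (vars F j) ∧ α₂ a (not b) v ≡ not (memB v (vars F j) ∧ α₂ a b v)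
      here rewrite ∈⇒memB v∈j | α₂-v a b | α₂-v a (not b) = refl
      elsewhere : ∀ k → k ≢ v → α₂ a (not b) k ≡ α₂ a b k
      elsewhere k k≢v = cong (fromMaybe false) (trans (set-elsewhere (set ρ₁ u a) (not b) k≢v) (sym (set-elsewhere (set ρ₁ u a) b k≢v)))
    flip-u : ∀ a b → parity (not a) b ≡ not (parity a b)
    flip-u a b = xorB-flip (λ i → memB i (vars F j) ∧ α₂ (not a) b i) (λ i → memB i (vars F j) ∧ α₂ a b i) u
      here λ k k≢u → cong (memB k (vars F j) ∧_) (elsewhere k k≢u)
      where
      α₂-u : ∀ a → α₂ a b u ≡ a
      α₂-u a = complete-fixed (ρ₂ a b) (const false) (trans (set-elsewhere (set ρ₁ u a) b u≢v) (set-here ρ₁ u a))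
      here : memB u (vars F j) ∧ α₂ (not a) b u ≡ not (memB u (vars F j) ∧ α₂ a b u)
      here rewrite ∈⇒memB u∈j | α₂-u a | α₂-u (not a) = refl
      elsewhere : ∀ k → k ≢ u → α₂ (not a) b k ≡ α₂ a b k
      elsewhere k k≢u with k Fin.≟ v
      ... | yes refl = trans (α₂-v (not a) b) (sym (α₂-v a b))
      ... | no  k≢v  = cong (fromMaybe false) (trans (trans (set-elsewhere (set ρ₁ u (not a)) b k≢v) (set-elsewhere ρ₁ (not a) k≢u))
                                              (sym (trans (set-elsewhere (set ρ₁ u a) b k≢v) (set-elsewhere ρ₁ a k≢u))))
    parity-c : parity false c ≡ rhs F j
    parity-c with parity false false in eq | rhs F j
    ... | false | false = eq
    ... | false | true  = trans (flip-v false false) (cong not eq)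
    ... | true  | false = trans (flip-v false false) (cong not eq)
    ... | true  | true  = eq
    -- Flipping both `u` and `v` preserves the parity, so the antipodal choice is a solution as
    -- well.
    parity-¬c : parity true (not c) ≡ rhs F j
    parity-¬c = trans (flip-u false (not c)) (trans (cong not (flip-v false c)) (trans (Bool.not-involutive _) parity-c))
    allFixed : ∀ a b {i} → i ∈ vars F j → Fixed (ρ₂ a b) i
    allFixed a b {i} i∈j with i Fin.≟ v
    ... | yes refl = b , set-here (set ρ₁ u a) v b
    ... | no  i≢v with i Fin.≟ u
    ...   | yes refl = a , trans (set-elsewhere (set ρ₁ u a) b i≢v) (set-here ρ₁ u a)
    ...   | no  i≢u  = let d , eq = fixed₁ (∈-allFin i) (Sub.x∈p∧x≢y⇒x∈p-y (Sub.x∈p∧x≢y⇒x∈p-y i∈j i≢u) i≢v)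
                       in d , trans (set-elsewhere (set ρ₁ u a) b i≢v) (trans (set-elsewhere ρ₁ a i≢u) eq)
    within₂ : ∀ a b → FixedWithin ρ (vars F j) (ρ₂ a b)
    within₂ a b i f with fixed-set (set ρ₁ u a) b f
    ... | inj₂ refl = inj₂ v∈j
    ... | inj₁ f′ with fixed-set ρ₁ a f′
    ...   | inj₂ refl = inj₂ u∈j
    ...   | inj₁ f″ with within₁ i f″
    ...     | inj₁ f‴ = inj₁ f‴
    ...     | inj₂ i∈ = inj₂ (Sub.p─q⊆p _ _ (Sub.p─q⊆p _ _ i∈))
    setTo : ∀ a b → parity a b ≡ rhs F j → Violated (ρ₂ a b) I → ∃ λ (e : Extension ρ I (vars F j)) → Solves (Extension.after e) j
    setTo a b par v₂ =
        extension (ρ₂ a b) v₂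
          (⊑-trans extends₁ (⊑-trans (⊑-set ρ₁ a free₁ᵤ) (⊑-set (set ρ₁ u a) b (trans (set-elsewhere ρ₁ a (u≢v ∘ sym)) free₁ᵥ))))
          (within₂ a b)
      , λ α ρ₂⊑α → SatEq-cong j (λ {i} i∈j → let d , eq = allFixed a b i∈j in
          trans (complete-fixed (ρ₂ a b) (const false) eq) (sym (just-injective (ρ₂⊑α i d eq)))) par
    result : Violated (ρ₂ false c) I ⊎ Violated (ρ₂ true (not c)) I → ∃ λ (e : Extension ρ I (vars F j)) → Solves (Extension.after e) j
    result (inj₁ v₂) = setTo false c parity-c v₂
    result (inj₂ v₂) = setTo true (not c) parity-¬c v₂

-- Counting in finite subsets

countB-unique : ∀ {n} {f : Fin n → Bool} → countB f ≡ 1 → ∀ i j → f i ≡ true → f j ≡ true → i ≡ j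
countB-unique _ zero zero _ _ = refl
countB-unique {f = f} eq zero (suc j) fi fj rewrite fi =
  contradiction (ℕ.suc-injective eq) (ℕ.n>0⇒n≢0 (countB-pos j fj))
countB-unique {f = f} eq (suc i) zero fi fj rewrite fj =
  contradiction (ℕ.suc-injective eq) (ℕ.n>0⇒n≢0 (countB-pos i fi))
countB-unique {f = f} eq (suc i) (suc j) fi fj with f zero
... | true  = contradiction (ℕ.suc-injective eq) (ℕ.n>0⇒n≢0 (countB-pos i fi))
... | false = cong suc (countB-unique eq i j fi fj)

countB-zero : ∀ {n} {f : Fin n → Bool} → (∀ i → f i ≡ false) → countB f ≡ 0
countB-zero {zero}  _ = refl
countB-zero {suc n} f≗false rewrite f≗false zero = countB-zero (f≗false ∘ suc)

∣p∣≤∣p─q∣+∣q∣ : ∀ {n} (p q : Subset n) → ∣ p ∣ ℕ.≤ ∣ p ─ q ∣ ℕ.+ ∣ q ∣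
∣p∣≤∣p─q∣+∣q∣ p q = ℕ.≤-trans (Sub.p⊆q⇒∣p∣≤∣q∣ p⊆) (∣p∪q∣≤∣p∣+∣q∣ (p ─ q) q)
  where
  p⊆ : p ⊆ (p ─ q) ∪ q
  p⊆ {x} x∈p with x Sub.∈? q
  ... | yes x∈q = Sub.x∈p∪q⁺ (inj₂ x∈q)
  ... | no  x∉q = Sub.x∈p∪q⁺ (inj₁ (Sub.x∈p∧x∉q⇒x∈p─q x∈p x∉q))

∣p─q∣+∣q∣≤∣p∣ : ∀ {n} (p q : Subset n) → q ⊆ p → ∣ p ─ q ∣ ℕ.+ ∣ q ∣ ℕ.≤ ∣ p ∣
∣p─q∣+∣q∣≤∣p∣ []          []          _   = z≤n
∣p─q∣+∣q∣≤∣p∣ (false ∷ p) (true  ∷ q) q⊆p with () ← q⊆p Vec.here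
∣p─q∣+∣q∣≤∣p∣ (false ∷ p) (false ∷ q) q⊆p = ∣p─q∣+∣q∣≤∣p∣ p q (Sub.drop-∷-⊆ q⊆p)
∣p─q∣+∣q∣≤∣p∣ (true  ∷ p) (false ∷ q) q⊆p = s≤s (∣p─q∣+∣q∣≤∣p∣ p q (Sub.drop-∷-⊆ q⊆p))
∣p─q∣+∣q∣≤∣p∣ (true  ∷ p) (true  ∷ q) q⊆p =
  ℕ.≤-trans (ℕ.≤-reflexive (ℕ.+-suc ∣ p ─ q ∣ ∣ q ∣)) (s≤s (∣p─q∣+∣q∣≤∣p∣ p q (Sub.drop-∷-⊆ q⊆p)))

nonempty : ∀ {n} (p : Subset n) → 0 ℕ.< ∣ p ∣ → ∃ λ x → x ∈ p
nonempty {n} p 0<∣p∣ with Sub.nonempty? p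
... | yes ne = ne
... | no  ¬ne = contradiction (trans (cong ∣_∣ (Sub.Empty-unique ¬ne)) (Sub.∣⊥∣≡0 n)) (ℕ.n>0⇒n≢0 0<∣p∣)

twoElements : ∀ {n} (p : Subset n) → 2 ℕ.≤ ∣ p ∣ → ∃₂ λ x y → x ∈ p × y ∈ p × x ≢ y
twoElements p 2≤∣p∣
  with x , x∈p ← nonempty p (ℕ.≤-trans (s≤s z≤n) 2≤∣p∣)
  with y , y∈p-x ← nonempty (p - x) (ℕ.+-cancelʳ-< 1 _ _ (ℕ.≤-trans 2≤∣p∣
                     (subst (λ k → ∣ p ∣ ℕ.≤ ∣ p - x ∣ ℕ.+ k) (Sub.∣⁅x⁆∣≡1 x) (∣p∣≤∣p─q∣+∣q∣ p ⁅ x ⁆))))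
  = x , y , x∈p , Sub.p─q⊆p p ⁅ x ⁆ y∈p-x , λ { refl → x∈p─q⇒x∉q p ⁅ x ⁆ y∈p-x (Sub.x∈⁅x⁆ x) }

-- Induction on `T`: removing `N zero` from `S` loses at most one element, and the remaining sets
-- cover the rest.
covered : ∀ {n m} (S : Subset n) (T : Subset m) (N : Fin m → Subset n) →
  (∀ {v} → v ∈ S → ∃ λ j → j ∈ T × v ∈ N j) → (∀ {j} → j ∈ T → ∣ N j ∣ ℕ.≤ 1) → ∣ S ∣ ℕ.≤ ∣ T ∣
covered {n} S [] N cover _ with ∣ S ∣ in eq
... | zero  = z≤n
... | suc k with nonempty S (subst (0 ℕ.<_) (sym eq) (s≤s z≤n))
...   | v , v∈S with () ← proj₁ (proj₂ (cover v∈S))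
covered S (false ∷ T) N cover small = covered S T (N ∘ suc) cover′ (small ∘ Vec.there)
  where
  cover′ : ∀ {v} → v ∈ S → ∃ λ j → j ∈ T × v ∈ N (suc j)
  cover′ v∈S with suc j , Vec.there j∈T , v∈N ← cover v∈S = j , j∈T , v∈N
covered S (true ∷ T) N cover small = begin
  ∣ S ∣                              ≤⟨ ∣p∣≤∣p─q∣+∣q∣ S (N zero) ⟩
  ∣ S ─ N zero ∣ ℕ.+ ∣ N zero ∣      ≤⟨ ℕ.+-mono-≤ (covered (S ─ N zero) T (N ∘ suc) cover′ (small ∘ Vec.there)) (small Vec.here) ⟩
  ∣ T ∣ ℕ.+ 1                        ≡⟨ ℕ.+-comm ∣ T ∣ 1 ⟩
  suc ∣ T ∣                          ∎
  where
  open ℕ.≤-Reasoning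
  cover′ : ∀ {v} → v ∈ S ─ N zero → ∃ λ j → j ∈ T × v ∈ N (suc j)
  cover′ v∈ with cover (Sub.p─q⊆p S (N zero) v∈)
  ... | zero  , _ , v∈N = contradiction v∈N (x∈p─q⇒x∉q S (N zero) v∈)
  ... | suc j , Vec.there j∈T , v∈N = j , j∈T , v∈N

-- Boundaries and private pairs of variables

module Expansion {n m} (F : System n m) where

  open Clauses F

  adjacent : Subset m → Fin n → Fin m → Bool
  adjacent W v j = memB j W ∧ memB v (vars F j)

  adjacent⁺ : ∀ W v {j} → j ∈ W → v ∈ vars F j → adjacent W v j ≡ true
  adjacent⁺ W v j∈W v∈j rewrite ∈⇒memB j∈W = ∈⇒memB v∈j

  boundary⇒degree : ∀ W {v} → v ∈ boundary F W → countB (adjacent W v) ≡ 1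
  boundary⇒degree W {v} v∈δ = go (trans (sym (lookup∘tabulate _ v)) ([]=⇒lookup v∈δ))
    where
    go : ∀ {d} → (if d ℕ.≡ᵇ 1 then true else false) ≡ true → d ≡ 1
    go {d} eq with d ℕ.≡ᵇ 1 in eq′
    ... | true = ℕ.≡ᵇ⇒≡ d 1 (subst Data.Bool.T (sym eq′) _)

  degree⇒boundary : ∀ W {v} → countB (adjacent W v) ≡ 1 → v ∈ boundary F W
  degree⇒boundary W {v} eq = lookup⇒[]= v (boundary F W)
    (trans (lookup∘tabulate _ v) (cong (λ d → if d ℕ.≡ᵇ 1 then true else false) eq))

  boundary-unique : ∀ {W v i j} → v ∈ boundary F W → i ∈ W → v ∈ vars F i → j ∈ W → v ∈ vars F j → i ≡ j
  boundary-unique {W} {v} v∈δ i∈W v∈i j∈W v∈j = countB-unique (boundary⇒degree W v∈δ) _ _ (adjacent⁺ W v i∈W v∈i) (adjacent⁺ W v j∈W v∈j)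

  -- If no equation of `D ─ C` contained `v`, its degrees into `C` and `D` would agree and `v` would
  -- be a boundary variable of `C`.
  boundary-new : ∀ {C D v} → C ⊆ D → v ∈ boundary F D → v ∉ boundary F C → ∃ λ j → j ∈ D ─ C × v ∈ vars F j
  boundary-new {C} {D} {v} C⊆D v∈δD v∉δC with Fin.any? (λ j → j Sub.∈? D ─ C ×-dec v Sub.∈? vars F j)
  ... | yes found = found
  ... | no  none  = contradiction (degree⇒boundary C (trans (countB-cong same) (boundary⇒degree D v∈δD))) v∉δC
    where
    same : ∀ j → adjacent C v j ≡ adjacent D v j
    same j with memB v (vars F j) in v∈j
    ... | false = trans (Bool.∧-zeroʳ (memB j C)) (sym (Bool.∧-zeroʳ (memB j D)))
    ... | true with memB j C in j∈C | memB j D in j∈D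
    ...   | true  | true  = refl
    ...   | false | false = refl
    ...   | true  | false = trans (sym (∈⇒memB (C⊆D (memB⇒∈ j∈C)))) j∈D
    ...   | false | true  = contradiction
              (j , Sub.x∈p∧x∉q⇒x∈p─q (memB⇒∈ j∈D) (λ j∈C′ → contradiction (trans (sym j∈C) (∈⇒memB j∈C′)) λ ()) , memB⇒∈ v∈j) none

  boundary-∅ : boundary F ∅ ⊆ ∅
  boundary-∅ {v} v∈δ = contradiction (trans (sym (boundary⇒degree ∅ v∈δ)) (countB-zero none)) λ ()
    where
    none : ∀ j → adjacent ∅ v j ≡ false
    none j with memB j (∅ {m}) in eq
    ... | false = refl
    ... | true  = contradiction (memB⇒∈ {S = ∅ {m}} eq) Sub.∉⊥

  -- Boundary variables of `D` occur in exactly one of its equations, so `u` and `v` belong to `j`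
  -- alone within `D`.
  record PrivatePair (C D : Subset m) (q : Subset n) : Set where
    constructor privatePair
    field
      {j}     : Fin m
      {u v}   : Fin n
      j∈D     : j ∈ D
      j∉C     : j ∉ C
      u≢v     : u ≢ v
      u∈j     : u ∈ vars F j
      v∈j     : v ∈ vars F j
      u∈δ     : u ∈ boundary F D
      v∈δ     : v ∈ boundary F D
      u∉q     : u ∉ q
      v∉q     : v ∉ q

  -- The 3 matches the expansion `s + 3`: after subtracting `3 * ∣ C ∣`, expansion leaves
  -- `s * ∣ C ∣ ≤ ∣ q ∣`.
  Gap≤ : Subset n → Subset m → Set
  Gap≤ q C = ∣ boundary F C ─ q ∣ ℕ.≤ 3 ℕ.* ∣ C ∣

  -- If every equation of `D ─ C` had at most one new boundary variable outside `q ∪ N`, then the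
  -- boundary of `D` outside `q` would have at most `3∣C∣ + ∣N∣ + ∣D ─ C∣` elements, which is at
  -- most `3∣D∣`. The gap conditions refer to the old `q`, while the pair found also avoids the
  -- fresh queries `N`.
  findPrivatePair : ∀ {C D q} N → C ⊆ D → ∣ C ∣ ℕ.< ∣ D ∣ → Gap≤ q C → ¬ Gap≤ q D → ∣ N ∣ ℕ.≤ 2 → PrivatePair C D (q ∪ N)
  findPrivatePair {C} {D} {q} N C⊆D C<D gapC gapD ∣N∣≤2
    with Fin.any? (λ j → j Sub.∈? D ─ C ×-dec 2 ℕ.≤? ∣ S ∩ vars F j ∣)
    where
    S = boundary F D ─ (q ∪ N) ─ boundary F C
  ... | yes (j , j∈ , two)
    with u , v , u∈ , v∈ , u≢v ← twoElements _ two
    with u∈S , u∈j ← Sub.x∈p∩q⁻ _ _ u∈ | v∈S , v∈j ← Sub.x∈p∩q⁻ _ _ v∈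
    = privatePair (Sub.p─q⊆p D C j∈) (x∈p─q⇒x∉q D C j∈) u≢v u∈j v∈j
        (Sub.p─q⊆p _ (q ∪ N) (Sub.p─q⊆p _ (boundary F C) u∈S)) (Sub.p─q⊆p _ (q ∪ N) (Sub.p─q⊆p _ (boundary F C) v∈S))
        (x∈p─q⇒x∉q _ (q ∪ N) (Sub.p─q⊆p _ (boundary F C) u∈S)) (x∈p─q⇒x∉q _ (q ∪ N) (Sub.p─q⊆p _ (boundary F C) v∈S))
  ... | no none = contradiction (count ∣S∣≤∣D─C∣) gapD
    where
    S = boundary F D ─ (q ∪ N) ─ boundary F C
    ∣S∣≤∣D─C∣ : ∣ S ∣ ℕ.≤ ∣ D ─ C ∣
    ∣S∣≤∣D─C∣ = covered S (D ─ C) (λ j → S ∩ vars F j)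
      (λ v∈S → let j , j∈ , v∈j = boundary-new C⊆D (Sub.p─q⊆p _ (q ∪ N) (Sub.p─q⊆p _ (boundary F C) v∈S)) (x∈p─q⇒x∉q _ (boundary F C) v∈S)
               in j , j∈ , Sub.x∈p∩q⁺ (v∈S , v∈j))
      (λ {j} j∈ → ℕ.≤-pred (ℕ.≰⇒> λ two → none (j , j∈ , two)))
    split : boundary F D ─ q ⊆ (boundary F C ─ q) ∪ (N ∪ S)
    split {v} v∈ with v Sub.∈? N | v Sub.∈? boundary F C
    ... | yes v∈N | _       = Sub.x∈p∪q⁺ (inj₂ (Sub.x∈p∪q⁺ (inj₁ v∈N)))
    ... | no  _   | yes v∈C = Sub.x∈p∪q⁺ (inj₁ (Sub.x∈p∧x∉q⇒x∈p─q v∈C (x∈p─q⇒x∉q _ q v∈)))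
    ... | no  v∉N | no  v∉C = Sub.x∈p∪q⁺ (inj₂ (Sub.x∈p∪q⁺ (inj₂
            (Sub.x∈p∧x∉q⇒x∈p─q (Sub.x∈p∧x∉q⇒x∈p─q (Sub.p─q⊆p _ q v∈) v∉q∪N) v∉C))))
      where
      v∉q∪N : v ∉ q ∪ N
      v∉q∪N v∈q∪N with Sub.x∈p∪q⁻ q N v∈q∪N
      ... | inj₁ v∈q = x∈p─q⇒x∉q _ q v∈ v∈q
      ... | inj₂ v∈N = v∉N v∈N
    open ℕ.≤-Reasoning
    x = ∣ D ─ C ∣
    0<x : 0 ℕ.< x
    0<x = ℕ.+-cancelʳ-< ∣ C ∣ 0 x (ℕ.<-≤-trans C<D (∣p∣≤∣p─q∣+∣q∣ D C))
    -- The origin of the constant 3: one variable for each new equation, plus two fresh queries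
    -- charged to at least one new equation.
    2+x≤3x : 2 ℕ.+ x ℕ.≤ 3 ℕ.* x
    2+x≤3x = begin
      2 ℕ.+ x                ≡⟨ ℕ.+-comm 2 x ⟩
      x ℕ.+ (1 ℕ.+ (1 ℕ.+ 0)) ≤⟨ ℕ.+-monoʳ-≤ x (ℕ.+-mono-≤ 0<x (ℕ.+-monoˡ-≤ 0 0<x)) ⟩
      3 ℕ.* x                ∎
    count : ∣ S ∣ ℕ.≤ x → Gap≤ q D
    count ∣S∣≤x = begin
      ∣ boundary F D ─ q ∣                         ≤⟨ Sub.p⊆q⇒∣p∣≤∣q∣ split ⟩
      ∣ (boundary F C ─ q) ∪ (N ∪ S) ∣             ≤⟨ ∣p∪q∣≤∣p∣+∣q∣ (boundary F C ─ q) (N ∪ S) ⟩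
      ∣ boundary F C ─ q ∣ ℕ.+ ∣ N ∪ S ∣           ≤⟨ ℕ.+-mono-≤ gapC (∣p∪q∣≤∣p∣+∣q∣ N S) ⟩
      3 ℕ.* ∣ C ∣ ℕ.+ (∣ N ∣ ℕ.+ ∣ S ∣)            ≤⟨ ℕ.+-monoʳ-≤ (3 ℕ.* ∣ C ∣) (ℕ.+-mono-≤ ∣N∣≤2 ∣S∣≤x) ⟩
      3 ℕ.* ∣ C ∣ ℕ.+ (2 ℕ.+ x)                    ≤⟨ ℕ.+-monoʳ-≤ (3 ℕ.* ∣ C ∣) 2+x≤3x ⟩
      3 ℕ.* ∣ C ∣ ℕ.+ 3 ℕ.* x                      ≡⟨ ℕ.*-distribˡ-+ 3 ∣ C ∣ x ⟨
      3 ℕ.* (∣ C ∣ ℕ.+ x)                          ≡⟨ cong (3 ℕ.*_) (ℕ.+-comm ∣ C ∣ x) ⟩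
      3 ℕ.* (x ℕ.+ ∣ C ∣)                          ≤⟨ ℕ.*-monoʳ-≤ 3 (∣p─q∣+∣q∣≤∣p∣ D C C⊆D) ⟩
      3 ℕ.* ∣ D ∣                                  ∎

  -- Closing sets of equations and walking down the derivation

  module Play (r : ℕ) where

    Maximal : Subset n → Subset m → Set
    Maximal q C = ∀ D → C ⊆ D → ∣ C ∣ ℕ.< ∣ D ∣ → ∣ D ∣ ℕ.≤ r → ¬ Gap≤ q D

    -- Each enlargement adds at least one equation and sizes are capped by `r`, so the fuel cannot
    -- run out before a maximal set is reached.
    closure : ∀ q fuel C → r ℕ.≤ fuel ℕ.+ ∣ C ∣ → ∣ C ∣ ℕ.≤ r → Gap≤ q C →
      ∃ λ D → C ⊆ D × ∣ D ∣ ℕ.≤ r × Gap≤ q D × Maximal q D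
    closure q zero C r≤C C≤r gap = C , (λ x → x) , C≤r , gap , λ D _ C<D D≤r _ → ℕ.<⇒≱ C<D (ℕ.≤-trans D≤r r≤C)
    closure q (suc fuel) C r≤ C≤r gap
      with Sub.anySubset? (λ D → C Sub.⊆? D ×-dec ∣ C ∣ ℕ.<? ∣ D ∣ ×-dec ∣ D ∣ ℕ.≤? r ×-dec ∣ boundary F D ─ q ∣ ℕ.≤? 3 ℕ.* ∣ D ∣)
    ... | no  none = C , (λ x → x) , C≤r , gap , λ D C⊆D C<D D≤r gapD → none (D , (λ {x} → C⊆D {x}) , C<D , D≤r , gapD)
    ... | yes (D , C⊆D , C<D , D≤r , gapD)
      with E , D⊆E , rest ← closure q fuel D (ℕ.≤-trans r≤ (subst (ℕ._≤ fuel ℕ.+ ∣ D ∣) (ℕ.+-suc fuel ∣ C ∣) (ℕ.+-monoʳ-≤ fuel C<D))) D≤r gapD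
      = E , (λ {x} x∈C → D⊆E (C⊆D x∈C)) , rest

    -- The invariant: closed equations are already solved, and every fixed variable was queried or
    -- occurs in a closed equation.
    record Position (C : Subset m) (q : Subset n) (I : Ineq n) : Set where
      constructor mkPosition
      field
        ρ        : Partial n
        violated : Violated ρ I
        solves   : ∀ {j} → j ∈ C → Solves ρ j
        fixed    : ∀ {v} → Fixed ρ v → v ∈ q ⊎ ∃ λ j → j ∈ C × v ∈ vars F j

    solves-mono : ∀ {ρ ρ′ j} → ρ ⊑ ρ′ → Solves ρ j → Solves ρ′ j
    solves-mono ρ⊑ρ′ solves α ρ′⊑α = solves α (⊑-trans ρ⊑ρ′ ρ′⊑α)

    -- A fixed `v` outside `q` would occur in some equation of `C`; being a boundary variable of
    -- `D`, it would force that equation to be `j`, which is not in `C`.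
    private-free : ∀ {C D q I j v} (P : Position C q I) → C ⊆ D → j ∈ D → j ∉ C → v ∈ vars F j → v ∈ boundary F D → v ∉ q →
      Free (Position.ρ P) v
    private-free {v = v} P C⊆D j∈D j∉C v∈j v∈δ v∉q with fixed-or-free (Position.ρ P) v
    ... | inj₂ free = free
    ... | inj₁ f with Position.fixed P f
    ...   | inj₁ v∈q = contradiction v∈q v∉q
    ...   | inj₂ (i , i∈C , v∈i) = contradiction (subst (_∈ _) (boundary-unique v∈δ (C⊆D i∈C) v∈i j∈D v∈j) i∈C) j∉C

    private-twoFree : ∀ {B C D q I} → (P : Position C q I) → C ⊆ D → (pp : PrivatePair B D q) → PrivatePair.j pp ∉ C →
      TwoFree (Position.ρ P) (PrivatePair.j pp)
    private-twoFree P C⊆D (privatePair j∈D _ u≢v u∈j v∈j u∈δ v∈δ u∉q v∉q) j∉C =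
      twoFree u∈j v∈j u≢v (private-free P C⊆D j∈D j∉C u∈j u∈δ u∉q) (private-free P C⊆D j∈D j∉C v∈j v∈δ v∉q)

    addEquation : ∀ {B D q I} (pp : PrivatePair B D q) → Position (D - PrivatePair.j pp) q I → Position D q I
    addEquation {B} {D} {q} {I} pp P = extend (fixEquation I ρ j violated
        (private-twoFree P (Sub.p─q⊆p D ⁅ j ⁆) pp (λ j∈ → x∈p─q⇒x∉q D ⁅ j ⁆ j∈ (Sub.x∈⁅x⁆ j))))
      where
      open PrivatePair pp
      open Position P
      extend : (∃ λ (e : Extension ρ I (vars F j)) → Solves (Extension.after e) j) → Position D q I
      extend (extension ρ′ violated′ extends within , solvesⱼ) = mkPosition ρ′ violated′ solves′ fixed′
        where
        solves′ : ∀ {i} → i ∈ D → Solves ρ′ i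
        solves′ {i} i∈D with i Fin.≟ j
        ... | yes refl = solvesⱼ
        ... | no  i≢j  = solves-mono extends (solves (Sub.x∈p∧x≢y⇒x∈p-y i∈D i≢j))
        widen : ∀ {v} → v ∈ q ⊎ (∃ λ i → i ∈ D - j × v ∈ vars F i) → v ∈ q ⊎ ∃ λ i → i ∈ D × v ∈ vars F i
        widen (inj₁ v∈q)             = inj₁ v∈q
        widen (inj₂ (i , i∈ , v∈i)) = inj₂ (i , Sub.p─q⊆p D ⁅ j ⁆ i∈ , v∈i)
        fixed′ : ∀ {v} → Fixed ρ′ v → v ∈ q ⊎ ∃ λ i → i ∈ D × v ∈ vars F i
        fixed′ {v} f with within v f
        ... | inj₂ v∈j = inj₂ (j , j∈D , v∈j)
        ... | inj₁ f′  = widen (fixed f′)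

    -- The order of closing is found from the top: an equation of `D` with a private pair is
    -- removed, the smaller set is closed first, and the pair is then still free. Every set strictly
    -- between `C` and `D`, and `D` itself, violates the gap condition for the old `q` by maximality
    -- of `C`. The number `k` bounds how many equations remain to be closed.
    grow : ∀ {C q N I} → ∣ N ∣ ℕ.≤ 2 → Gap≤ q C → Maximal q C → Position C (q ∪ N) I →
      ∀ k D → C ⊆ D → ∣ D ∣ ℕ.≤ k ℕ.+ ∣ C ∣ → ∣ D ∣ ℕ.≤ r → Position D (q ∪ N) I
    grow {C} {q} {N} {I} ∣N∣≤2 gap maximal P k D C⊆D D≤k D≤r with ∣ C ∣ ℕ.<? ∣ D ∣
    ... | no C≮D = mkPosition ρ violated (solves ∘ D⊆C) fixed′
      where
      open Position P
      D⊆C : D ⊆ C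
      D⊆C {j} j∈D with j Sub.∈? C
      ... | yes j∈C = j∈C
      ... | no  j∉C = contradiction (Sub.p⊂q⇒∣p∣<∣q∣ (C⊆D , j , j∈D , j∉C)) C≮D
      fixed′ : ∀ {v} → Fixed ρ v → v ∈ q ∪ N ⊎ ∃ λ j → j ∈ D × v ∈ vars F j
      fixed′ f with fixed f
      ... | inj₁ v∈q = inj₁ v∈q
      ... | inj₂ (j , j∈C , v∈j) = inj₂ (j , C⊆D j∈C , v∈j)
    grow ∣N∣≤2 gap maximal P zero D C⊆D D≤k D≤r | yes C<D = contradiction D≤k (ℕ.<⇒≱ C<D)
    grow {C} {q} {N} {I} ∣N∣≤2 gap maximal P (suc k) D C⊆D D≤k D≤r | yes C<D =
      step (findPrivatePair N C⊆D C<D gap (maximal D C⊆D C<D D≤r) ∣N∣≤2)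
      where
      step : PrivatePair C D (q ∪ N) → Position D (q ∪ N) I
      step pp = addEquation pp (grow ∣N∣≤2 gap maximal P k (D - j)
          (λ i∈C → Sub.x∈p∧x≢y⇒x∈p-y (C⊆D i∈C) λ { refl → j∉C i∈C })
          (ℕ.≤-pred (ℕ.≤-trans (Sub.x∈p⇒∣p-x∣<∣p∣ j∈D) D≤k)) (ℕ.≤-trans (Sub.∣p─q∣≤∣p∣ D ⁅ j ⁆) D≤r))
        where open PrivatePair pp

    record State (I : Ineq n) : Set where
      constructor state
      field
        C        : Subset m
        q        : Subset n
        C≤r      : ∣ C ∣ ℕ.≤ r
        gap      : Gap≤ q C
        maximal  : Maximal q C
        position : Position C q I

    -- More queries only shrink the gap, so the old `C` seeds the closure for `q ∪ N`, while its
    -- maximality for the old `q` drives `grow`.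
    advance : ∀ {I J} (s : State J) → Query (Position.ρ (State.position s)) I →
      ∃ λ (s′ : State I) → ∣ State.q s′ ∣ ℕ.≤ ∣ State.q s ∣ ℕ.+ 2
    advance {I} (state C q C≤r gap maximal (mkPosition ρ _ solves fixed)) (query ρ′ N violated′ extends ∣N∣≤2 within)
      with D , C⊆D , D≤r , gap′ , maximal′ ← closure (q ∪ N) r C (ℕ.m≤m+n r ∣ C ∣) C≤r
             (ℕ.≤-trans (Sub.p⊆q⇒∣p∣≤∣q∣ {p = boundary F C ─ (q ∪ N)} {boundary F C ─ q}
               (λ {v} v∈ → Sub.x∈p∧x∉q⇒x∈p─q (Sub.p─q⊆p (boundary F C) (q ∪ N) v∈)
                 (λ v∈q → x∈p─q⇒x∉q (boundary F C) (q ∪ N) v∈ (Sub.x∈p∪q⁺ (inj₁ v∈q))))) gap)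
      = state D (q ∪ N) D≤r gap′ maximal′
          (grow ∣N∣≤2 gap maximal (mkPosition ρ′ violated′ (solves-mono extends ∘ solves) fixed′) ∣ D ∣ D C⊆D (ℕ.m≤m+n ∣ D ∣ ∣ C ∣) D≤r)
      , ℕ.≤-trans (∣p∪q∣≤∣p∣+∣q∣ q N) (ℕ.+-monoʳ-≤ ∣ q ∣ ∣N∣≤2)
      where
      fixed′ : ∀ {v} → Fixed ρ′ v → v ∈ q ∪ N ⊎ ∃ λ j → j ∈ C × v ∈ vars F j
      fixed′ {v} f with within v f
      ... | inj₂ v∈N = inj₁ (Sub.x∈p∪q⁺ (inj₂ v∈N))
      ... | inj₁ f′ with fixed f′
      ...   | inj₁ v∈q = inj₁ (Sub.x∈p∪q⁺ (inj₁ v∈q))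
      ...   | inj₂ v∈C = inj₂ v∈C

    budget : ∀ {a b d e N} → d ℕ.≤ e → b ℕ.≤ a ℕ.+ 2 → a ℕ.+ 2 ℕ.* suc e ℕ.≤ N → b ℕ.+ 2 ℕ.* d ℕ.≤ N
    budget {a} {b} {d} {e} {N} d≤e b≤a+2 a≤N = begin
      b ℕ.+ 2 ℕ.* d          ≤⟨ ℕ.+-mono-≤ b≤a+2 (ℕ.*-monoʳ-≤ 2 d≤e) ⟩
      a ℕ.+ 2 ℕ.+ 2 ℕ.* e    ≡⟨ ℕ.+-assoc a 2 (2 ℕ.* e) ⟩
      a ℕ.+ (2 ℕ.+ 2 ℕ.* e)  ≡⟨ cong (a ℕ.+_) (ℕ.*-suc 2 e) ⟨
      a ℕ.+ 2 ℕ.* suc e      ≤⟨ a≤N ⟩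
      N                      ∎
      where open ℕ.≤-Reasoning

    -- The equation of the private pair lies outside `C`, hence is `j`, and its two variables are
    -- free.
    unclosed⇒¬violated : ∀ {C q} j β → C ⊆ C ∪ ⁅ j ⁆ → (P : Position C q (clauseIneq F j β)) → ¬ PrivatePair C (C ∪ ⁅ j ⁆) q
    unclosed⇒¬violated {C} j β C⊆D P pp with Sub.x∈p∪q⁻ C ⁅ j ⁆ (PrivatePair.j∈D pp)
    ... | inj₁ i∈C = PrivatePair.j∉C pp i∈C
    ... | inj₂ i∈j = twoFree⇒¬violated (Position.ρ P) j β
            (subst (TwoFree (Position.ρ P)) (Sub.x∈⁅y⁆⇒x≡y j i∈j) (private-twoFree P C⊆D pp (PrivatePair.j∉C pp)))
            (Position.violated P)

    -- Induction on the derivation: each descent to a premise spends at most two queries and lowers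
    -- the depth, so `∣ q ∣ + 2 * depth` stays within `N`.
    noDerivation : ∀ {N} → (∀ C q → ∣ C ∣ ℕ.≤ r → ∣ q ∣ ℕ.≤ N → Gap≤ q C → ∣ C ∣ ℕ.< r) →
      ∀ {J} (p : SCP F J) (s : State J) → ¬ (∣ State.q s ∣ ℕ.+ 2 ℕ.* depth p ℕ.≤ N)
    noDerivation C<r (axiom j β ¬sat) (state C q C≤r gap maximal P) q≤N with j Sub.∈? C
    ... | yes j∈C = solved⇒¬violated (Position.ρ P) j β (Position.solves P j∈C) ¬sat (Position.violated P)
    ... | no  j∉C = unclosed⇒¬violated j β C⊆D P pp
      where
      D = C ∪ ⁅ j ⁆
      C⊆D : C ⊆ D
      C⊆D i∈C = Sub.x∈p∪q⁺ (inj₁ i∈C)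
      C<D : ∣ C ∣ ℕ.< ∣ D ∣
      C<D = Sub.p⊂q⇒∣p∣<∣q∣ (C⊆D , j , Sub.x∈p∪q⁺ (inj₂ (Sub.x∈⁅x⁆ j)) , j∉C)
      -- Strictness of `∣ C ∣ < r` leaves room for one more equation, so maximality of `C` applies
      -- to `D`.
      D≤r : ∣ D ∣ ℕ.≤ r
      D≤r = ℕ.≤-trans (subst (λ k → ∣ D ∣ ℕ.≤ ∣ C ∣ ℕ.+ k) (Sub.∣⁅x⁆∣≡1 j) (∣p∪q∣≤∣p∣+∣q∣ C ⁅ j ⁆))
              (subst (ℕ._≤ r) (ℕ.+-comm 1 ∣ C ∣) (C<r C q C≤r (ℕ.m+n≤o⇒m≤o ∣ q ∣ q≤N) gap))
      pp : PrivatePair C D q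
      pp = subst (PrivatePair C D) (Sub.∪-identityʳ q)
             -- At an axiom nothing is queried, so the set of fresh queries is empty.
             (findPrivatePair ∅ C⊆D C<D gap (maximal D C⊆D C<D D≤r) (ℕ.≤-trans (ℕ.≤-reflexive (Sub.∣⊥∣≡0 n)) z≤n))
    noDerivation C<r (rule0 {J} valid) s q≤N
      with falsified J (Position.ρ (State.position s)) (const true) (Position.violated (State.position s))
    ... | inj₁ ¬sat = ¬sat (valid _)
    ... | inj₂ ¬sat = ¬sat (valid _)
    noDerivation C<r (rule1 {I} {J} p I⇒J) s q≤N
      -- A rule with one premise is treated as having the same premise twice.
      with _ , Q ← violatePremise (const I) J (Position.ρ (State.position s)) (λ α sat → I⇒J α (sat zero)) (Position.violated (State.position s))
      with s′ , q′≤q+2 ← advance s Q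
      = noDerivation C<r p s′ (budget ℕ.≤-refl q′≤q+2 q≤N)
    noDerivation C<r (rule2 {I} {I′} {J} p p′ I⇒J) s q≤N
      with violatePremise (I VF.∷ I′ VF.∷ VF.[]) J (Position.ρ (State.position s)) (λ α sat → I⇒J α (sat zero) (sat (suc zero))) (Position.violated (State.position s))
    ... | zero , Q with s′ , q′≤q+2 ← advance s Q
      = noDerivation C<r p s′ (budget (ℕ.m≤m⊔n (depth p) (depth p′)) q′≤q+2 q≤N)
    ... | suc zero , Q with s′ , q′≤q+2 ← advance s Q
      = noDerivation C<r p′ s′ (budget (ℕ.m≤n⊔m (depth p) (depth p′)) q′≤q+2 q≤N)

-- Rational arithmetic

open import Data.Rational using (ℚ; _+_; _*_; _≤_; ½; 0ℚ; 1ℚ; NonNegative; toℚᵘ; _≤?_)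
import Data.Rational as ℚ
import Data.Rational.Properties as ℚ
import Data.Rational.Unnormalised as ℚᵘ
open ℚᵘ using (mkℚᵘ; *≡*; *≤*)
import Data.Rational.Unnormalised.Properties as ℚᵘ

toℚᵘ-fromℕ : ∀ k → toℚᵘ (fromℕ k) ℚᵘ.≃ mkℚᵘ (+ k) 0
toℚᵘ-fromℕ k = ℚ.toℚᵘ-fromℚᵘ (mkℚᵘ (+ k) 0)

fromℕ-+ : ∀ a b → fromℕ (a ℕ.+ b) ≡ fromℕ a + fromℕ b
fromℕ-+ a b = ℚ.toℚᵘ-injective (ℚᵘ.≃-trans (toℚᵘ-fromℕ (a ℕ.+ b)) (ℚᵘ.≃-trans
  (*≡* (cong (ℤ._* + 1) (sym (cong₂ ℤ._+_ (ℤ.*-identityʳ (+ a)) (ℤ.*-identityʳ (+ b))))))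
  (ℚᵘ.≃-sym (ℚᵘ.≃-trans (ℚ.toℚᵘ-homo-+ (fromℕ a) (fromℕ b)) (ℚᵘ.+-cong (toℚᵘ-fromℕ a) (toℚᵘ-fromℕ b))))))

fromℕ-mono-≤ : ∀ a b → a ℕ.≤ b → fromℕ a ≤ fromℕ b
fromℕ-mono-≤ a b a≤b = ℚ.toℚᵘ-cancel-≤ (begin
  toℚᵘ (fromℕ a)  ≃⟨ toℚᵘ-fromℕ a ⟩
  mkℚᵘ (+ a) 0    ≤⟨ *≤* (ℤ.*-monoʳ-≤-nonNeg (+ 1) (+≤+ a≤b)) ⟩
  mkℚᵘ (+ b) 0    ≃⟨ toℚᵘ-fromℕ b ⟨
  toℚᵘ (fromℕ b)  ∎)
  where open ℚᵘ.≤-Reasoning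

fromℕ-3* : ∀ a → fromℕ (3 ℕ.* a) ≡ fromℕ 3 * fromℕ a
fromℕ-3* a = begin
  fromℕ (3 ℕ.* a)                    ≡⟨ fromℕ-+ a (a ℕ.+ (a ℕ.+ 0)) ⟩
  x + fromℕ (a ℕ.+ (a ℕ.+ 0))        ≡⟨ cong (λ y → x + y) (fromℕ-+ a (a ℕ.+ 0)) ⟩
  x + (x + fromℕ (a ℕ.+ 0))          ≡⟨ cong (λ b → x + (x + fromℕ b)) (ℕ.+-identityʳ a) ⟩
  x + (x + x)                        ≡⟨ cong (λ y → y + (y + y)) (ℚ.*-identityˡ x) ⟨
  1ℚ * x + (1ℚ * x + 1ℚ * x)         ≡⟨ cong (λ y → 1ℚ * x + y) (ℚ.*-distribʳ-+ x 1ℚ 1ℚ) ⟨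
  1ℚ * x + (1ℚ + 1ℚ) * x             ≡⟨ ℚ.*-distribʳ-+ x 1ℚ (1ℚ + 1ℚ) ⟨
  fromℕ 3 * x                        ∎
  where
  open ≡-Reasoning
  x = fromℕ a

record Weighted (s : ℚ) (c N : ℕ) : Set where
  constructor weighted
  field
    weight≤ : s * fromℕ c ≤ fromℕ N

weighted? : ∀ s c N → Dec (Weighted s c N)
weighted? s c N = map′ weighted Weighted.weight≤ (s * fromℕ c ≤? fromℕ N)

-- The term `3 * c` is cancelled from `(s + 3) * c ≤ b ≤ 3 * c + N`.
expansion⇒weighted : ∀ s c b N → (s + fromℕ 3) * fromℕ c ≤ fromℕ b → b ℕ.≤ 3 ℕ.* c ℕ.+ N → Weighted s c N
expansion⇒weighted s c b N expands b≤ = weighted (ℚ.≮⇒≥ λ N<sc →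
  ℚ.<-irrefl refl (ℚ.<-≤-trans (ℚ.+-monoʳ-< (fromℕ 3 * fromℕ c) N<sc) (begin
    fromℕ 3 * fromℕ c + s * fromℕ c  ≡⟨ ℚ.+-comm (fromℕ 3 * fromℕ c) (s * fromℕ c) ⟩
    s * fromℕ c + fromℕ 3 * fromℕ c  ≡⟨ ℚ.*-distribʳ-+ (fromℕ c) s (fromℕ 3) ⟨
    (s + fromℕ 3) * fromℕ c          ≤⟨ expands ⟩
    fromℕ b                          ≤⟨ fromℕ-mono-≤ b (3 ℕ.* c ℕ.+ N) b≤ ⟩
    fromℕ (3 ℕ.* c ℕ.+ N)            ≡⟨ fromℕ-+ (3 ℕ.* c) N ⟩
    fromℕ (3 ℕ.* c) + fromℕ N        ≡⟨ cong (_+ fromℕ N) (fromℕ-3* c) ⟩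
    fromℕ 3 * fromℕ c + fromℕ N      ∎)))
  where open ℚ.≤-Reasoning

halve : ∀ s r d → Weighted s r (2 ℕ.* d) → fromℕ r * s * ½ ≤ fromℕ d
halve s r d (weighted h) = begin
  fromℕ r * s * ½            ≡⟨ cong (_* ½) (ℚ.*-comm (fromℕ r) s) ⟩
  s * fromℕ r * ½            ≤⟨ ℚ.*-monoʳ-≤-nonNeg ½ h ⟩
  fromℕ (2 ℕ.* d) * ½        ≡⟨ cong (_* ½) (trans (fromℕ-+ d (d ℕ.+ 0)) (cong (λ e → fromℕ d + fromℕ e) (ℕ.+-identityʳ d))) ⟩
  (fromℕ d + fromℕ d) * ½    ≡⟨ ℚ.*-distribʳ-+ ½ (fromℕ d) (fromℕ d) ⟩
  fromℕ d * ½ + fromℕ d * ½  ≡⟨ ℚ.*-distribˡ-+ (fromℕ d) ½ ½ ⟨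
  fromℕ d * (½ + ½)          ≡⟨⟩
  fromℕ d * 1ℚ               ≡⟨ ℚ.*-identityʳ (fromℕ d) ⟩
  fromℕ d                    ∎
  where open ℚ.≤-Reasoning

-- For positive `k` the assumption forces `s ≤ 0`, and then the bound for `r` is trivial. This
-- covers the case in which the empty set of equations is not maximal at the start.
nonPos-rescale : ∀ s k r N → 0 ℕ.< k → Weighted s k 0 → Weighted s r N
nonPos-rescale s (suc k) r N _ (weighted sk≤0) = weighted (begin
  s * fromℕ r   ≤⟨ ℚ.*-monoʳ-≤-nonNeg (fromℕ r) {{r≥0}} s≤0 ⟩
  0ℚ * fromℕ r  ≡⟨ ℚ.*-zeroˡ (fromℕ r) ⟩
  0ℚ            ≤⟨ fromℕ-mono-≤ 0 N ℕ.z≤n ⟩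
  fromℕ N       ∎)
  where
  open ℚ.≤-Reasoning
  r≥0 : NonNegative (fromℕ r)
  r≥0 = ℚ.nonNegative (fromℕ-mono-≤ 0 r ℕ.z≤n)
  s≤0 : s ≤ 0ℚ
  s≤0 = ℚ.*-cancelʳ-≤-pos (fromℕ (suc k)) {{ℚ.positive (ℚ.<-≤-trans (ℚ.*<* (ℤ.+<+ (ℕ.s≤s ℕ.z≤n))) (fromℕ-mono-≤ 1 (suc k) (ℕ.s≤s ℕ.z≤n)))}}
          (subst (s * fromℕ (suc k) ≤_) (sym (ℚ.*-zeroˡ (fromℕ (suc k)))) sk≤0)

-- Assembling the depth bound

module _ {n m} (F : System n m) (r : ℕ) where

  open Expansion F
  open Play r

  start : ∀ {I} → (∀ α → ¬ SatIneq α I) → Maximal ∅ ∅ → State I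
  start {I} unsat maximal = record
    { C        = ∅
    ; q        = ∅
    ; C≤r      = subst (ℕ._≤ r) (sym (Sub.∣⊥∣≡0 m)) z≤n
    ; gap      = ℕ.≤-trans (ℕ.≤-trans (Sub.∣p─q∣≤∣p∣ (boundary F ∅) ∅)
                             (subst (∣ boundary F ∅ ∣ ℕ.≤_) (Sub.∣⊥∣≡0 n) (Sub.p⊆q⇒∣p∣≤∣q∣ boundary-∅))) z≤n
    ; maximal  = maximal
    ; position = mkPosition (const nothing) (unsat⇒violated I unsat) (λ j∈∅ → contradiction j∈∅ Sub.∉⊥) λ ()
    }

expander⇒weighted : ∀ {n m} (F : System n m) r s → IsBoundaryExpander F r (s + fromℕ 3) →
  ∀ C N → ∣ C ∣ ℕ.≤ r → ∣ boundary F C ∣ ℕ.≤ 3 ℕ.* ∣ C ∣ ℕ.+ N → Weighted s ∣ C ∣ N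
expander⇒weighted F r s expander C N C≤r = expansion⇒weighted s ∣ C ∣ ∣ boundary F C ∣ N (expander C C≤r)

depth-weighted : ∀ {n m} (F : System n m) r s →
  (∀ C N → ∣ C ∣ ℕ.≤ r → ∣ boundary F C ∣ ℕ.≤ 3 ℕ.* ∣ C ∣ ℕ.+ N → Weighted s ∣ C ∣ N) →
  ∀ {I} → (∀ α → ¬ SatIneq α I) → (p : SCP F I) → Weighted s r (2 ℕ.* depth p)
-- The bound is a decidable comparison of rationals, so it may be proved by contradiction.
depth-weighted {n} F r s expands unsat p = decidable-stable (weighted? s r (2 ℕ.* depth p)) λ ¬weighted →
  let
    closed-weighted : ∀ C q N → ∣ C ∣ ℕ.≤ r → ∣ q ∣ ℕ.≤ N → Gap≤ q C → Weighted s ∣ C ∣ N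
    closed-weighted C q N C≤r q≤N gap = expands C N C≤r
      (ℕ.≤-trans (∣p∣≤∣p─q∣+∣q∣ (boundary F C) q) (ℕ.+-mono-≤ gap q≤N))
    closed<r : ∀ C q → ∣ C ∣ ℕ.≤ r → ∣ q ∣ ℕ.≤ 2 ℕ.* depth p → Gap≤ q C → ∣ C ∣ ℕ.< r
    -- A closed set of exactly `r` equations would already give `s * r ≤ 2 * depth p`.
    closed<r C q C≤r q≤2d gap = ℕ.≤∧≢⇒< C≤r λ C≡r → ¬weighted
      (subst (λ c → Weighted s c (2 ℕ.* depth p)) C≡r (closed-weighted C q (2 ℕ.* depth p) C≤r q≤2d gap))
    maximal : Maximal ∅ ∅
    -- A nonempty closed set without any query gives `s * ∣ D ∣ ≤ 0`, the trivial case of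
    -- nonpositive `s`.
    maximal D ∅⊆D ∅<D D≤r gap = ¬weighted (nonPos-rescale s ∣ D ∣ r (2 ℕ.* depth p) (ℕ.≤-<-trans z≤n ∅<D)
      (closed-weighted D ∅ 0 D≤r (ℕ.≤-reflexive (Sub.∣⊥∣≡0 n)) gap))
  in noDerivation closed<r p (start F r unsat maximal) (ℕ.≤-reflexive (cong (ℕ._+ 2 ℕ.* depth p) (Sub.∣⊥∣≡0 n)))
  where
  open Expansion F
  open Play r

theorem5p8 : {n m : ℕ} (F : System n m) (r : ℕ) (s : ℚ) →
    IsBoundaryExpander F r (s + fromℕ 3) →
    (π : Refutation F) → fromℕ r * s * ½ ≤ fromℕ (refDepth π)
theorem5p8 F r s expander π =
  halve s r (refDepth π) (depth-weighted F r s (expander⇒weighted F r s expander) (unsat π) (proof π))
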